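{- Let $q$ be a prime power and $m,l,k$ integers with $3\le k\le\min\{m+1,l\}$. Then there is a disjoint decomposition $$\Omega_k^{k-1}=\bigsqcup_{r=1}^{k-1}\Omega_{k,r}^{k-1}=\bigsqcup_{r=1}^{k-1}\ \bigsqcup_{T\in\mathcal F_{k,r}^{k-1}}T^G .$$
   Context: $V$ is an $m$-dimensional vector space over $\mathrm{GF}(q^l)$ with basis $Y_1,\dots,Y_m$, regarded also as an $ml$-dimensional space over $\mathrm{GF}(q)$. $G=\mathrm{GL}(m,q^l)$ acts $\mathrm{GF}(q^l)$-linearly on $V$ and hence on the $\mathrm{GF}(q)$-subspaces of $V$; $W^G=\{g(W):g\in G\}$ is the $G$-orbit of $W$. $\langle\cdot\rangle$ denotes $\mathrm{GF}(q)$-span and $\langle\cdot\rangle_{\mathrm{GF}(q^l)}$ denotes $\mathrm{GF}(q^l)$-span. $\Omega_i^j$ is the set of $\mathrm{GF}(q)$-subspaces $W\le V$ with $\dim_{\mathrm{GF}(q)}W=i$ and $\dim_{\mathrm{GF}(q^l)}\langle W\rangle_{\mathrm{GF}(q^l)}=j$. For $1\le r\le k-1$ and $u_1,\dots,u_r\in\mathrm{GF}(q^l)$ with $1,u_1,\dots,u_r$ linearly independent over $\mathrm{GF}(q)$, put $$T(u_1,\dots,u_r)=\langle Y_1,\dots,Y_{k-1},\,u_1Y_1+\cdots+u_rY_r\rangle\in\Omega_k^{k-1}.$$ $\Omega_{k,r}^{k-1}$ is the union of all $G$-orbits $T(u_1,\dots,u_r)^G$ over all such $u_1,\dots,u_r$,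 and $\mathcal F_{k,r}^{k-1}$ is a complete set of representatives of the $G$-orbits on $\Omega_{k,r}^{k-1}$. -}

module Defs where

open import Level using (Level; _⊔_) renaming (suc to lsuc)
open import Algebra.Bundles using (CommutativeRing; Ring)
open import Algebra.Module.Bundles using (LeftModule)
open import Algebra.Module.Morphism.Structures using (IsLeftModuleIsomorphism)
open import Algebra.Morphism.Bundles using (RingHomomorphism)
import Algebra.Module.Construct.TensorUnit as TensorUnit
import Algebra.Properties.Monoid.Sum as MonoidSum
open import Data.Fin.Base using (Fin; inject≤)
open import Data.Nat.Base using (ℕ; _+_; _∸_; _^_; _≤_; _⊓_)
import Data.Nat.Properties as ℕ
open import Data.Nat.Primality using (Prime)
open import Data.Product.Base using (Σ; ∃; ∃₂; _×_; _,_; proj₁)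
open import Data.Vec.Functional using (Vector; _∷_)
open import Function.Bundles using (Inverse)
open import Relation.Binary.Core using (Rel)
open import Relation.Binary.PropositionalEquality using (_≡_; setoid)
open import Relation.Nullary.Negation using (¬_)
open import Relation.Unary using (Pred; _∈_; _⊆_; _≐_; ⋃)

IsPrimePower : ℕ → Set
IsPrimePower q = ∃₂ λ p e → Prime p × 1 ≤ e × q ≡ p ^ e

-- A field with exactly n elements.
record GF (c ℓ : Level) (n : ℕ) : Set (lsuc (c ⊔ ℓ)) where
  field
    commutativeRing : CommutativeRing c ℓ

  open CommutativeRing commutativeRing public
    renaming (setoid to ≈-setoid)

  field
    0≉1      : ¬ (0# ≈ 1#)
    inverse  : ∀ x → ¬ (x ≈ 0#) → ∃ λ y → x * y ≈ 1#
    elements : Inverse ≈-setoid (setoid (Fin n))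

-- Automatically injective, so GF(q) is regarded as a subfield of GF(q^l).
FieldEmbedding : ∀ {c ℓ c′ ℓ′ n n′} → GF c ℓ n → GF c′ ℓ′ n′ → Set (c ⊔ ℓ ⊔ c′ ⊔ ℓ′)
FieldEmbedding F K = RingHomomorphism (GF.rawRing F) (GF.rawRing K)

module _ {c ℓ c′ ℓ′ v ℓv : Level} {R : Ring c ℓ} {S : Ring c′ ℓ′} where

  restrictScalars : RingHomomorphism (Ring.rawRing R) (Ring.rawRing S) →
                    LeftModule S v ℓv → LeftModule R v ℓv
  restrictScalars ι M = record
    { Carrierᴹ     = M.Carrierᴹ
    ; _≈ᴹ_         = M._≈ᴹ_
    ; _+ᴹ_         = M._+ᴹ_
    ; _*ₗ_         = λ a x → ι.⟦ a ⟧ M.*ₗ x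
    ; 0ᴹ           = M.0ᴹ
    ; -ᴹ_          = M.-ᴹ_
    ; isLeftModule = record
      { isLeftSemimodule = record
        { +ᴹ-isCommutativeMonoid = M.+ᴹ-isCommutativeMonoid
        ; isPreleftSemimodule    = record
          { *ₗ-cong      = λ a≈b → M.*ₗ-cong (ι.⟦⟧-cong a≈b)
          ; *ₗ-zeroˡ     = λ x → M.≈ᴹ-trans (M.*ₗ-congʳ ι.0#-homo) (M.*ₗ-zeroˡ x)
          ; *ₗ-distribʳ  = λ x a b →
              M.≈ᴹ-trans (M.*ₗ-congʳ (ι.+-homo a b)) (M.*ₗ-distribʳ x ι.⟦ a ⟧ ι.⟦ b ⟧)
          ; *ₗ-identityˡ = λ x → M.≈ᴹ-trans (M.*ₗ-congʳ ι.1#-homo) (M.*ₗ-identityˡ x)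
          ; *ₗ-assoc     = λ a b x →
              M.≈ᴹ-trans (M.*ₗ-congʳ (ι.*-homo a b)) (M.*ₗ-assoc ι.⟦ a ⟧ ι.⟦ b ⟧ x)
          ; *ₗ-zeroʳ     = λ a → M.*ₗ-zeroʳ ι.⟦ a ⟧
          ; *ₗ-distribˡ  = λ a → M.*ₗ-distribˡ ι.⟦ a ⟧
          }
        }
      ; -ᴹ‿cong    = M.-ᴹ‿cong
      ; -ᴹ‿inverse = M.-ᴹ‿inverse
      }
    }
    where
    module M = LeftModule M
    module ι = RingHomomorphism ι

-- Sets of vectors are predicates.  They are compared by _≐_, and only
-- subspaces are required to respect the equality _≈ᴹ_ of vectors.
module LinearAlgebra {c ℓ v ℓv} {R : Ring c ℓ} (M : LeftModule R v ℓv) where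

  open Ring R using (Carrier; _≈_; 0#)
  open LeftModule M
  open MonoidSum +ᴹ-monoid using (sum)

  lincomb : ∀ {n} → Vector Carrier n → Vector Carrierᴹ n → Carrierᴹ
  lincomb a x = sum λ i → a i *ₗ x i

  Range : ∀ {n} → Vector Carrierᴹ n → Pred Carrierᴹ ℓv
  Range x y = ∃ λ i → y ≈ᴹ x i

  Span : ∀ {s} → Pred Carrierᴹ s → Pred Carrierᴹ (c ⊔ v ⊔ ℓv ⊔ s)
  Span S y = ∃ λ n → Σ (Vector Carrier n) λ a → Σ (Vector Carrierᴹ n) λ x →
             (∀ i → x i ∈ S) × y ≈ᴹ lincomb a x

  LinearlyIndependent : ∀ {n} → Vector Carrierᴹ n → Set (c ⊔ ℓ ⊔ ℓv)
  LinearlyIndependent x = ∀ a → lincomb a x ≈ᴹ 0ᴹ → ∀ i → a i ≈ 0#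

  record IsSubspace {s} (W : Pred Carrierᴹ s) : Set (c ⊔ v ⊔ ℓv ⊔ s) where
    field
      respects  : ∀ {x y} → x ≈ᴹ y → x ∈ W → y ∈ W
      0-closed  : 0ᴹ ∈ W
      +-closed  : ∀ {x y} → x ∈ W → y ∈ W → (x +ᴹ y) ∈ W
      *ₗ-closed : ∀ a {x} → x ∈ W → (a *ₗ x) ∈ W

  record IsBasis {s n} (b : Vector Carrierᴹ n) (W : Pred Carrierᴹ s)
         : Set (c ⊔ ℓ ⊔ v ⊔ ℓv ⊔ s) where
    field
      independent : LinearlyIndependent b
      spans       : W ≐ Span (Range b)

  HasDim : ∀ {s} → Pred Carrierᴹ s → ℕ → Set (c ⊔ ℓ ⊔ v ⊔ ℓv ⊔ s)
  HasDim W n = Σ (Vector Carrierᴹ n) λ b → IsBasis b W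

-- A is the disjoint union of the B i, where the index set I carries the
-- equality _~_.
record IsDisjointUnion {x a b i e} {X : Set x} {I : Set i} (_~_ : Rel I e)
                       (A : Pred X a) (B : I → Pred X b)
                       : Set (x ⊔ a ⊔ b ⊔ i ⊔ e) where
  field
    union    : A ≐ ⋃ I B
    disjoint : ∀ {i j x} → x ∈ B i → x ∈ B j → i ~ j

-- The index set 1 ≤ r ≤ n.
[1⋯_] : ℕ → Set
[1⋯ n ] = ∃ λ r → 1 ≤ r × r ≤ n

SameValue : ∀ {n} → Rel [1⋯ n ] _
SameValue r r′ = proj₁ r ≡ proj₁ r′

module Setting
  {c ℓ c′ ℓ′ v ℓv} {q Q m : ℕ}
  (F : GF c ℓ q) (K : GF c′ ℓ′ Q) (ι : FieldEmbedding F K)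
  (V : LeftModule (GF.ring K) v ℓv)
  (Y : Vector (LeftModule.Carrierᴹ V) m)
  where

  private
    module K = GF K

  open LeftModule V

  V/F : LeftModule (GF.ring F) v ℓv
  V/F = restrictScalars ι V

  K/F : LeftModule (GF.ring F) c′ ℓ′
  K/F = restrictScalars ι (TensorUnit.leftModule {R = K.ring})

  module OverF = LinearAlgebra V/F
  module OverK = LinearAlgebra V

  -- GL(m, K), identified through Y with the K-linear automorphisms of V.
  IsGL : (Carrierᴹ → Carrierᴹ) → Set (c′ ⊔ v ⊔ ℓv)
  IsGL = IsLeftModuleIsomorphism rawLeftModule rawLeftModule

  image : ∀ {s} → (Carrierᴹ → Carrierᴹ) → Pred Carrierᴹ s → Pred Carrierᴹ (v ⊔ ℓv ⊔ s)
  image g W y = ∃ λ x → x ∈ W × y ≈ᴹ g x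

  -- W ∈ Orbit T  says that W = g(T) for some g in G.
  Orbit : ∀ {s t} → Pred Carrierᴹ t → Pred (Pred Carrierᴹ s) (c′ ⊔ v ⊔ ℓv ⊔ s ⊔ t)
  Orbit T W = ∃ λ g → IsGL g × W ≐ image g T

  record Ω {s} (i j : ℕ) (W : Pred Carrierᴹ s)
         : Set (c ⊔ ℓ ⊔ c′ ⊔ ℓ′ ⊔ v ⊔ ℓv ⊔ s) where
    field
      isSubspace : OverF.IsSubspace W
      dimOverF   : OverF.HasDim W i
      dimOverK   : OverK.HasDim (OverK.Span W) j

  -- T(u₁,…,u_r) and Ω_{k,r}^{k-1}, with n standing for k - 1.
  T : ∀ {n r} → n ≤ m → r ≤ n → Vector K.Carrier r → Pred Carrierᴹ (c ⊔ v ⊔ ℓv)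
  T n≤m r≤n u = OverF.Span (OverF.Range (w ∷ λ i → Y (inject≤ i n≤m)))
    where
    w : Carrierᴹ
    w = OverK.lincomb u λ i → Y (inject≤ (inject≤ i r≤n) n≤m)

  Ωᵣ : ∀ {n s} → n ≤ m → [1⋯ n ] →
       Pred (Pred Carrierᴹ s) (c ⊔ ℓ ⊔ c′ ⊔ ℓ′ ⊔ v ⊔ ℓv ⊔ s)
  Ωᵣ n≤m (r , _ , r≤n) W = Σ (Vector K.Carrier r) λ u →
    LinearAlgebra.LinearlyIndependent K/F (K.1# ∷ u) × W ∈ Orbit (T n≤m r≤n u)

  -- 𝓕 contains exactly one element (up to _≐_) of each G-orbit on S.
  record IsRepresentatives {s a f} (S : Pred (Pred Carrierᴹ s) a)
                           (𝓕 : Pred (Pred Carrierᴹ s) f)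
                           : Set (c′ ⊔ v ⊔ ℓv ⊔ lsuc s ⊔ a ⊔ f) where
    field
      contained : 𝓕 ⊆ S
      exists    : ∀ {W} → W ∈ S → ∃ λ T′ → T′ ∈ 𝓕 × T′ ∈ Orbit W
      unique    : ∀ {W T′ T″} → W ∈ S → T′ ∈ 𝓕 → T″ ∈ 𝓕 →
                  T′ ∈ Orbit W → T″ ∈ Orbit W → T′ ≐ T″

  RepIndex : ∀ {i s f} {I : Set i} → (I → Pred (Pred Carrierᴹ s) f) → Set (v ⊔ i ⊔ lsuc s ⊔ f)
  RepIndex {I = I} 𝓕 = Σ I λ r → ∃ λ T′ → T′ ∈ 𝓕 r

  OrbitAt : ∀ {i s f} {I : Set i} (𝓕 : I → Pred (Pred Carrierᴹ s) f) →
            RepIndex 𝓕 → Pred (Pred Carrierᴹ s) (c′ ⊔ v ⊔ ℓv ⊔ s)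
  OrbitAt 𝓕 (_ , T′ , _) = Orbit T′

  -- Equality of pairs (r , T′); this makes a disjoint union over RepIndex 𝓕
  -- the iterated disjoint union over r and over T′ ∈ 𝓕 r.
  SameRep : ∀ {i e s f} {I : Set i} → Rel I e → (𝓕 : I → Pred (Pred Carrierᴹ s) f) →
            Rel (RepIndex 𝓕) (e ⊔ v ⊔ s)
  SameRep _~_ 𝓕 (r , T′ , _) (r′ , T″ , _) = r ~ r′ × T′ ≐ T″

k∸1≤m : ∀ {k m l} → k ≤ (m + 1) ⊓ l → k ∸ 1 ≤ m
k∸1≤m {k} {m} {l} k≤ = begin
  k ∸ 1      ≤⟨ ℕ.∸-monoˡ-≤ 1 (ℕ.≤-trans k≤ (ℕ.m⊓n≤m (m + 1) l)) ⟩
  m + 1 ∸ 1  ≡⟨ ℕ.m+n∸n≡m m 1 ⟩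
  m          ∎
  where open ℕ.≤-Reasoning

{-# OPTIONS --safe #-}
-- Let w₀,…,w_n (n = k − 1) be an F-basis of W ∈ Ω_k^{k-1}.  These n + 1 vectors
-- lie in an n-dimensional K-space, so they satisfy a K-linear relation, which is
-- unique up to a factor.  Its coefficients span an F-subspace of K, whose dimension
-- r + 1 does not depend on the basis of W or on the factor: this is the invariant
-- that separates the Ω_{k,r}^{k-1}.  Conversely, a change of the F-basis of W makes
-- the nonzero coefficients of the relation F-independent.  Solving the relation for
-- one of its vectors shows that W is spanned over F by a K-independent family z₁,…,z_n
-- and u₁ z₁ + ⋯ + u_r z_r; an extension of z to a K-basis of V yields g ∈ G with
-- g(Y_i) = z_i, so W = g(T(u₁,…,u_r)).
module Submission where

open import Defs
open import Algebra.Bundles using (Ring)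
open import Algebra.Module.Bundles using (LeftModule)
open import Algebra.Module.Morphism.Structures using (IsLeftModuleIsomorphism)
open import Algebra.Module.Morphism.Construct.Composition using (isLeftModuleIsomorphism)
open import Algebra.Morphism.Bundles using (RingHomomorphism)
import Algebra.Module.Properties.LeftModule as LeftModuleProperties
import Algebra.Properties.CommutativeMonoid.Sum as CommutativeMonoidSum
import Algebra.Properties.CommutativeSemigroup as CommutativeSemigroupProperties
import Algebra.Properties.Ring as RingProperties
import Algebra.Properties.Semiring.Sum as SemiringSum
open import Data.Fin.Base using (Fin; zero; suc; inject≤; punchIn; punchOut; _↑ˡ_; _↑ʳ_; splitAt; join)
import Data.Fin.Properties as Fin
open import Data.Nat.Base using (ℕ; zero; suc; _+_; _∸_; _^_; _≤_; _⊓_; z≤n; s≤s; s≤s⁻¹)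
import Data.Nat.Properties as ℕ
open import Data.Product.Base using (∃; _×_; _,_; proj₁; proj₂)
open import Data.Sum.Base using (inj₁; inj₂)
open import Data.Unit.Base using (tt)
open import Data.Vec.Functional using (Vector; []; _∷_; head; tail; _++_; insertAt; removeAt)
import Data.Vec.Functional.Properties as Vector
open import Function.Base using (_∘_)
open import Function.Bundles using (Inverse)
open import Level using (_⊔_) renaming (suc to lsuc)
open import Relation.Binary.Definitions using () renaming (Decidable to Decidable₂)
open import Relation.Binary.PropositionalEquality as ≡ using (_≡_)
import Relation.Binary.Reasoning.Setoid as SetoidReasoning
open import Relation.Nullary.Decidable using (Dec; yes; no; ¬?; map′; decidable-stable)
open import Relation.Nullary.Negation using (¬_; contradiction)
open import Relation.Unary using (Pred; Decidable; U; _∈_; _∉_; _⊆_; _≐_)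

-- Unit vectors and zero padding of coefficient vectors.

module Coefficients {c ℓ} (R : Ring c ℓ) where

  open Ring R using (Carrier; 0#; 1#)

  δ : ∀ {n} → Fin n → Vector Carrier n
  δ zero    zero    = 1#
  δ zero    (suc j) = 0#
  δ (suc i) zero    = 0#
  δ (suc i) (suc j) = δ i j

  δ-sym : ∀ {n} (i j : Fin n) → δ i j ≡ δ j i
  δ-sym zero    zero    = ≡.refl
  δ-sym zero    (suc j) = ≡.refl
  δ-sym (suc i) zero    = ≡.refl
  δ-sym (suc i) (suc j) = δ-sym i j

  -- Padding turns a combination of the first `r` members of a family into one of the whole family;
  -- see `lincomb-pad`.
  pad : ∀ {r n} → r ≤ n → Vector Carrier r → Vector Carrier n
  pad z≤n       a i       = 0#
  pad (s≤s r≤n) a zero    = a zero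
  pad (s≤s r≤n) a (suc i) = pad r≤n (tail a) i

  pad-inject≤ : ∀ {r n} (r≤n : r ≤ n) (a : Vector Carrier r) i → pad r≤n a (inject≤ i r≤n) ≡ a i
  pad-inject≤ (s≤s r≤n) a zero    = ≡.refl
  pad-inject≤ (s≤s r≤n) a (suc i) = pad-inject≤ r≤n (tail a) i

  pad-∈ : ∀ {r n p} {P : Pred Carrier p} (r≤n : r ≤ n) {a : Vector Carrier r} →
          0# ∈ P → (∀ i → a i ∈ P) → ∀ i → pad r≤n a i ∈ P
  pad-∈ z≤n       0∈P a∈P i       = 0∈P
  pad-∈ (s≤s r≤n) 0∈P a∈P zero    = a∈P zero
  pad-∈ {P = P} (s≤s r≤n) 0∈P a∈P (suc i) = pad-∈ {P = P} r≤n 0∈P (a∈P ∘ suc) i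

-- Linear combinations, spans and independence over a ring.

module LincombProperties {c ℓ v ℓv} {R : Ring c ℓ} (M : LeftModule R v ℓv) where

  open Ring R using (Carrier; _≈_; 0#; 1#; -_) renaming (_+_ to _+ᴿ_; _*_ to _*ᴿ_; _-_ to _-ᴿ_)
  module R = Ring R
  open LeftModule M
  open LeftModuleProperties M
  open LinearAlgebra M
  open Coefficients R public
  open CommutativeMonoidSum +ᴹ-commutativeMonoid using (sum-cong-≋; ∑-distrib-+)
  module ΣR = CommutativeMonoidSum R.+-commutativeMonoid
  open SetoidReasoning ≈ᴹ-setoid

  -- Collects the contributions of one fixed vector, after multiples of it have been added to the
  -- other vectors of a relation.
  lincomb-multiples : ∀ {n} (a b : Vector Carrier n) y →
                      lincomb a (λ i → b i *ₗ y) ≈ᴹ (ΣR.sum λ i → a i *ᴿ b i) *ₗ y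
  lincomb-multiples {zero}  a b y = ≈ᴹ-sym (*ₗ-zeroˡ y)
  lincomb-multiples {suc n} a b y = ≈ᴹ-trans
    (+ᴹ-cong (≈ᴹ-sym (*ₗ-assoc _ _ y)) (lincomb-multiples (tail a) (tail b) y))
    (≈ᴹ-sym (*ₗ-distribʳ y _ _))

  -- The span of a finite family with the family held fixed: unlike in `Span (Range x)`, a
  -- membership proof is one coefficient vector, which serves as coordinates and as a matrix row. As
  -- a record type it lets the family be inferred from a membership proof.
  record ⟨_⟩ {n} (x : Vector Carrierᴹ n) (y : Carrierᴹ) : Set (c ⊔ ℓv) where
    constructor _,_
    field
      coefficients : Vector Carrier n
      ≈lincomb     : y ≈ᴹ lincomb coefficients x

  -1*ₗ : ∀ x → (- 1#) *ₗ x ≈ᴹ -ᴹ x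
  -1*ₗ x = inverseˡ-uniqueᴹ _ _ (begin
    (- 1#) *ₗ x +ᴹ x        ≈⟨ +ᴹ-congˡ (*ₗ-identityˡ x) ⟨
    (- 1#) *ₗ x +ᴹ 1# *ₗ x  ≈⟨ *ₗ-distribʳ x (- 1#) 1# ⟨
    ((- 1#) +ᴿ 1#) *ₗ x     ≈⟨ *ₗ-congʳ (R.-‿inverseˡ 1#) ⟩
    0# *ₗ x                 ≈⟨ *ₗ-zeroˡ x ⟩
    0ᴹ                      ∎)

  lincomb-cong : ∀ {n} {a b : Vector Carrier n} {x y : Vector Carrierᴹ n} →
                 (∀ i → a i ≈ b i) → (∀ i → x i ≈ᴹ y i) → lincomb a x ≈ᴹ lincomb b y
  lincomb-cong a≈b x≈y = sum-cong-≋ λ i → *ₗ-cong (a≈b i) (x≈y i)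

  lincomb-congˡ : ∀ {n} {a b : Vector Carrier n} (x : Vector Carrierᴹ n) →
                  (∀ i → a i ≈ b i) → lincomb a x ≈ᴹ lincomb b x
  lincomb-congˡ x a≈b = lincomb-cong a≈b λ _ → ≈ᴹ-refl

  lincomb-congʳ : ∀ {n} (a : Vector Carrier n) {x y : Vector Carrierᴹ n} →
                  (∀ i → x i ≈ᴹ y i) → lincomb a x ≈ᴹ lincomb a y
  lincomb-congʳ a = lincomb-cong λ _ → R.refl

  lincomb-zeroˡ : ∀ {n} (x : Vector Carrierᴹ n) → lincomb (λ _ → 0#) x ≈ᴹ 0ᴹ
  lincomb-zeroˡ {zero}  x = ≈ᴹ-refl
  lincomb-zeroˡ {suc n} x = ≈ᴹ-trans (+ᴹ-cong (*ₗ-zeroˡ _) (lincomb-zeroˡ (tail x))) (+ᴹ-identityˡ 0ᴹ)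

  lincomb-zeroʳ : ∀ {n} (a : Vector Carrier n) → lincomb a (λ _ → 0ᴹ) ≈ᴹ 0ᴹ
  lincomb-zeroʳ {zero}  a = ≈ᴹ-refl
  lincomb-zeroʳ {suc n} a = ≈ᴹ-trans (+ᴹ-cong (*ₗ-zeroʳ _) (lincomb-zeroʳ (tail a))) (+ᴹ-identityˡ 0ᴹ)

  lincomb-+ˡ : ∀ {n} (a b : Vector Carrier n) x →
               lincomb (λ i → a i +ᴿ b i) x ≈ᴹ lincomb a x +ᴹ lincomb b x
  lincomb-+ˡ a b x = ≈ᴹ-trans (sum-cong-≋ λ i → *ₗ-distribʳ (x i) (a i) (b i))
    (∑-distrib-+ (λ i → a i *ₗ x i) (λ i → b i *ₗ x i))

  lincomb-+ʳ : ∀ {n} (a : Vector Carrier n) x y →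
               lincomb a (λ i → x i +ᴹ y i) ≈ᴹ lincomb a x +ᴹ lincomb a y
  lincomb-+ʳ a x y = ≈ᴹ-trans (sum-cong-≋ λ i → *ₗ-distribˡ (a i) (x i) (y i))
    (∑-distrib-+ (λ i → a i *ₗ x i) (λ i → a i *ₗ y i))

  lincomb--ʳ : ∀ {n} (a : Vector Carrier n) x → lincomb a (λ i → -ᴹ x i) ≈ᴹ -ᴹ lincomb a x
  lincomb--ʳ a x = inverseˡ-uniqueᴹ _ _ (≈ᴹ-trans (≈ᴹ-sym (lincomb-+ʳ a (λ i → -ᴹ x i) x))
    (≈ᴹ-trans (lincomb-congʳ a λ i → -ᴹ‿inverseˡ (x i)) (lincomb-zeroʳ a)))

  lincomb-*ˡ : ∀ {n} r (a : Vector Carrier n) x → lincomb (λ i → r *ᴿ a i) x ≈ᴹ r *ₗ lincomb a x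
  lincomb-*ˡ {zero}  r a x = ≈ᴹ-sym (*ₗ-zeroʳ r)
  lincomb-*ˡ {suc n} r a x = begin
    (r *ᴿ a zero) *ₗ x zero +ᴹ lincomb (λ i → r *ᴿ a (suc i)) (tail x)
      ≈⟨ +ᴹ-cong (*ₗ-assoc r (a zero) (x zero)) (lincomb-*ˡ r (tail a) (tail x)) ⟩
    r *ₗ (a zero *ₗ x zero) +ᴹ r *ₗ lincomb (tail a) (tail x)
      ≈⟨ *ₗ-distribˡ r _ _ ⟨
    r *ₗ lincomb a x ∎

  -- On coefficients this is the row vector `a` times the matrix `B`. It serves for products of
  -- base-change matrices and for transporting relations between bases.
  lincomb-lincomb : ∀ {m n} (a : Vector Carrier m) (B : Fin m → Vector Carrier n) x →
                    lincomb a (λ i → lincomb (B i) x) ≈ᴹ lincomb (λ j → ΣR.sum λ i → a i *ᴿ B i j) x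
  lincomb-lincomb {zero}  a B x = ≈ᴹ-sym (lincomb-zeroˡ x)
  lincomb-lincomb {suc m} a B x = begin
    a zero *ₗ lincomb (B zero) x +ᴹ lincomb (tail a) (λ i → lincomb (B (suc i)) x)
      ≈⟨ +ᴹ-cong (≈ᴹ-sym (lincomb-*ˡ (a zero) (B zero) x)) (lincomb-lincomb (tail a) (tail B) x) ⟩
    lincomb (λ j → a zero *ᴿ B zero j) x +ᴹ lincomb (λ j → ΣR.sum λ i → a (suc i) *ᴿ B (suc i) j) x
      ≈⟨ lincomb-+ˡ _ _ x ⟨
    lincomb (λ j → ΣR.sum λ i → a i *ᴿ B i j) x ∎

  lincomb-δ : ∀ {n} i (x : Vector Carrierᴹ n) → lincomb (δ i) x ≈ᴹ x i
  lincomb-δ zero    x = ≈ᴹ-trans (+ᴹ-cong (*ₗ-identityˡ _) (lincomb-zeroˡ (tail x))) (+ᴹ-identityʳ _)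
  lincomb-δ (suc i) x = ≈ᴹ-trans (+ᴹ-cong (*ₗ-zeroˡ _) (lincomb-δ i (tail x))) (+ᴹ-identityˡ _)

  lincomb-++ : ∀ {m n} (a : Vector Carrier (m + n)) (x : Vector Carrierᴹ m) (y : Vector Carrierᴹ n) →
               lincomb a (x ++ y) ≈ᴹ lincomb (a ∘ (_↑ˡ n)) x +ᴹ lincomb (a ∘ (m ↑ʳ_)) y
  lincomb-++ {zero}  a x y = ≈ᴹ-sym (+ᴹ-identityˡ _)
  lincomb-++ {suc m} a x y = begin
    a zero *ₗ x zero +ᴹ lincomb (tail a) (tail (x ++ y))
      ≈⟨ +ᴹ-congˡ (lincomb-congʳ (tail a) λ i → ≈ᴹ-reflexive (tail-++ i)) ⟩
    a zero *ₗ x zero +ᴹ lincomb (tail a) (tail x ++ y)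
      ≈⟨ +ᴹ-congˡ (lincomb-++ (tail a) (tail x) y) ⟩
    a zero *ₗ x zero +ᴹ (lincomb (tail a ∘ (_↑ˡ _)) (tail x) +ᴹ lincomb (tail a ∘ (m ↑ʳ_)) y)
      ≈⟨ +ᴹ-assoc _ _ _ ⟨
    lincomb (a ∘ (_↑ˡ _)) x +ᴹ lincomb (a ∘ (suc m ↑ʳ_)) y ∎
    where
    tail-++ : ∀ i → (x ++ y) (suc i) ≡ (tail x ++ y) i
    tail-++ i with splitAt m i
    ... | inj₁ _ = ≡.refl
    ... | inj₂ _ = ≡.refl

  lincomb-pad : ∀ {r n} (r≤n : r ≤ n) (a : Vector Carrier r) (x : Vector Carrierᴹ n) →
                lincomb (pad r≤n a) x ≈ᴹ lincomb a (λ i → x (inject≤ i r≤n))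
  lincomb-pad z≤n       a x = lincomb-zeroˡ x
  lincomb-pad (s≤s r≤n) a x = +ᴹ-congˡ (lincomb-pad r≤n (tail a) (tail x))

  lincomb∈ : ∀ {n p} {P : Pred Carrierᴹ p} → IsSubspace P → ∀ a {x : Vector Carrierᴹ n} →
             (∀ i → x i ∈ P) → lincomb a x ∈ P
  lincomb∈ {zero}  P a x∈P = IsSubspace.0-closed P
  lincomb∈ {suc n} P a x∈P =
    IsSubspace.+-closed P (IsSubspace.*ₗ-closed P (a zero) (x∈P zero)) (lincomb∈ P (tail a) (x∈P ∘ suc))

  -‿closed : ∀ {p} {P : Pred Carrierᴹ p} → IsSubspace P → ∀ {x} → x ∈ P → (-ᴹ x) ∈ P
  -‿closed P x∈P = IsSubspace.respects P (-1*ₗ _) (IsSubspace.*ₗ-closed P (- 1#) x∈P)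

  ⟨⟩-isSubspace : ∀ {n} (x : Vector Carrierᴹ n) → IsSubspace ⟨ x ⟩
  ⟨⟩-isSubspace x = record
    { respects  = λ { y≈z (a , y≈) → a , ≈ᴹ-trans (≈ᴹ-sym y≈z) y≈ }
    ; 0-closed  = _ , ≈ᴹ-sym (lincomb-zeroˡ x)
    ; +-closed  = λ { (a , y≈) (b , z≈) → _ , ≈ᴹ-trans (+ᴹ-cong y≈ z≈) (≈ᴹ-sym (lincomb-+ˡ a b x)) }
    ; *ₗ-closed = λ { r (a , y≈) → _ , ≈ᴹ-trans (*ₗ-congˡ y≈) (≈ᴹ-sym (lincomb-*ˡ r a x)) }
    }

  ∈⟨⟩ : ∀ {n} (x : Vector Carrierᴹ n) i → x i ∈ ⟨ x ⟩
  ∈⟨⟩ x i = δ i , ≈ᴹ-sym (lincomb-δ i x)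

  ⟨⟩-least : ∀ {n p} {P : Pred Carrierᴹ p} {x : Vector Carrierᴹ n} →
             IsSubspace P → (∀ i → x i ∈ P) → ⟨ x ⟩ ⊆ P
  ⟨⟩-least P x∈P (a , y≈) = IsSubspace.respects P (≈ᴹ-sym y≈) (lincomb∈ P a x∈P)

  ⟨⟩-mono : ∀ {m n} {x : Vector Carrierᴹ m} {y : Vector Carrierᴹ n} →
            (∀ i → x i ∈ ⟨ y ⟩) → ⟨ x ⟩ ⊆ ⟨ y ⟩
  ⟨⟩-mono {y = y} = ⟨⟩-least (⟨⟩-isSubspace y)

  Span-least : ∀ {s p} {S : Pred Carrierᴹ s} {P : Pred Carrierᴹ p} → IsSubspace P → S ⊆ P → Span S ⊆ P
  Span-least P S⊆P (_ , a , x , x∈S , y≈) = ⟨⟩-least P (S⊆P ∘ x∈S) (a , y≈)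

  ⟨⟩⊆Span : ∀ {n s} {S : Pred Carrierᴹ s} {x : Vector Carrierᴹ n} → (∀ i → x i ∈ S) → ⟨ x ⟩ ⊆ Span S
  ⟨⟩⊆Span x∈S (a , y≈) = _ , a , _ , x∈S , y≈

  ⊆Span : ∀ {s} {S : Pred Carrierᴹ s} → S ⊆ Span S
  ⊆Span {x = y} y∈S = 1 , δ zero , (λ _ → y) , (λ _ → y∈S) , ≈ᴹ-sym (lincomb-δ {1} zero λ _ → y)

  SpanRange≐⟨⟩ : ∀ {n} (x : Vector Carrierᴹ n) → Span (Range x) ≐ ⟨ x ⟩
  SpanRange≐⟨⟩ x =
    Span-least {S = Range x} (⟨⟩-isSubspace x)
      (λ { (i , y≈) → IsSubspace.respects (⟨⟩-isSubspace x) (≈ᴹ-sym y≈) (∈⟨⟩ x i) }) ,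
    ⟨⟩⊆Span {S = Range x} λ i → i , ≈ᴹ-refl

  ⟨⟩-cong : ∀ {n} {x y : Vector Carrierᴹ n} → (∀ i → x i ≈ᴹ y i) → ⟨ x ⟩ ⊆ ⟨ y ⟩
  ⟨⟩-cong x≈y (a , z≈) = a , ≈ᴹ-trans z≈ (lincomb-congʳ a x≈y)

  isSubspace-≐ : ∀ {s t} {S : Pred Carrierᴹ s} {T : Pred Carrierᴹ t} → S ≐ T → IsSubspace T → IsSubspace S
  isSubspace-≐ (S⊆T , T⊆S) T = record
    { respects  = λ x≈y x∈S → T⊆S (IsSubspace.respects T x≈y (S⊆T x∈S))
    ; 0-closed  = T⊆S (IsSubspace.0-closed T)
    ; +-closed  = λ x∈S y∈S → T⊆S (IsSubspace.+-closed T (S⊆T x∈S) (S⊆T y∈S))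
    ; *ₗ-closed = λ a x∈S → T⊆S (IsSubspace.*ₗ-closed T a (S⊆T x∈S))
    }

  ++-∈ : ∀ {m n p} {P : Pred Carrierᴹ p} {x : Vector Carrierᴹ m} {y : Vector Carrierᴹ n} →
         (∀ i → x i ∈ P) → (∀ i → y i ∈ P) → ∀ i → (x ++ y) i ∈ P
  ++-∈ {m} x∈P y∈P i with splitAt m i
  ... | inj₁ j = x∈P j
  ... | inj₂ j = y∈P j

  independent-injective : ∀ {n} {x : Vector Carrierᴹ n} → LinearlyIndependent x →
                          ∀ {a b} → lincomb a x ≈ᴹ lincomb b x → ∀ i → a i ≈ b i
  independent-injective {x = x} indep {a} {b} eq i =
    RingProperties.x∙y⁻¹≈ε⇒x≈y R (a i) (b i) (indep (λ j → a j -ᴿ b j) a-b≈0 i)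
    where
    a-b≈0 : lincomb (λ j → a j -ᴿ b j) x ≈ᴹ 0ᴹ
    a-b≈0 = begin
      lincomb (λ j → a j -ᴿ b j) x
        ≈⟨ lincomb-+ˡ a (λ j → - b j) x ⟩
      lincomb a x +ᴹ lincomb (λ j → - b j) x
        ≈⟨ +ᴹ-congˡ (lincomb-congˡ x λ j → R.sym (RingProperties.-1*x≈-x R (b j))) ⟩
      lincomb a x +ᴹ lincomb (λ j → (- 1#) *ᴿ b j) x
        ≈⟨ +ᴹ-congˡ (lincomb-*ˡ (- 1#) b x) ⟩
      lincomb a x +ᴹ (- 1#) *ₗ lincomb b x
        ≈⟨ +ᴹ-cong eq (-1*ₗ _) ⟩
      lincomb b x +ᴹ -ᴹ lincomb b x
        ≈⟨ -ᴹ‿inverseʳ _ ⟩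
      0ᴹ ∎

  independent-inject≤ : ∀ {r n} (r≤n : r ≤ n) {x : Vector Carrierᴹ n} → LinearlyIndependent x →
                        LinearlyIndependent (λ i → x (inject≤ i r≤n))
  independent-inject≤ r≤n {x} indep a eq i =
    R.trans (R.reflexive (≡.sym (pad-inject≤ r≤n a i)))
            (indep (pad r≤n a) (≈ᴹ-trans (lincomb-pad r≤n a x) eq) (inject≤ i r≤n))

-- Decidability over a finite field.

module FiniteField {c ℓ n} (F : GF c ℓ n) where

  open GF F
  open Inverse elements

  _≈?_ : Decidable₂ _≈_
  x ≈? y = map′
    (λ eq → trans (sym (strictlyInverseʳ x)) (trans (from-cong eq) (strictlyInverseʳ y)))
    to-cong (to x Fin.≟ to y)

  -- Exhaustive search, one entry at a time. The enumeration reaches each scalar only up to `≈`,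
  -- hence the invariance assumed of `P`.
  search : ∀ {m p} {P : Pred (Vector Carrier m) p} →
           (∀ {a b} → (∀ i → a i ≈ b i) → a ∈ P → b ∈ P) → Decidable P → Dec (∃ P)
  search {zero}  resp P? = map′ ([] ,_) (λ (_ , a∈P) → resp (λ ()) a∈P) (P? [])
  search {suc m} resp P? = map′
    (λ (k , a , a∈P) → from k ∷ a , a∈P)
    (λ (a , a∈P) → to (head a) , tail a ,
      resp (λ { zero → sym (strictlyInverseʳ (head a)) ; (suc i) → refl }) a∈P)
    (Fin.any? λ k → search (λ a≈b → resp λ { zero → refl ; (suc i) → a≈b i }) (λ a → P? (from k ∷ a)))

-- Linear dependence, dimension bounds and completion to a basis.

module Dimension {c ℓ v ℓv q} (F : GF c ℓ q) (M : LeftModule (GF.ring F) v ℓv) where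

  open GF F using (Carrier; _≈_; 0#; 1#; -_; 0≉1; inverse; ring)
    renaming (_+_ to _+ᴿ_; _*_ to _*ᴿ_)
  module F = GF F
  open FiniteField F
  open LeftModule M
  open LeftModuleProperties M
  open LinearAlgebra M
  open LincombProperties M
  open CommutativeMonoidSum +ᴹ-commutativeMonoid using (sum-remove)
  open SetoidReasoning ≈ᴹ-setoid

  lincomb-removeAt : ∀ {n} (a : Vector Carrier (suc n)) (x : Vector Carrierᴹ (suc n)) p →
                     lincomb a x ≈ᴹ a p *ₗ x p +ᴹ lincomb (removeAt a p) (removeAt x p)
  lincomb-removeAt a x p = sum-remove {i = p} (λ i → a i *ₗ x i)

  ∈⟨tail⟩ : ∀ {n} {b : Vector Carrierᴹ (suc n)} {y} (y∈⟨b⟩ : y ∈ ⟨ b ⟩) →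
            ⟨_⟩.coefficients y∈⟨b⟩ zero ≈ 0# → y ∈ ⟨ tail b ⟩
  ∈⟨tail⟩ (a , y≈) a₀≈0 = tail a , ≈ᴹ-trans y≈
    (≈ᴹ-trans (+ᴹ-congʳ (≈ᴹ-trans (*ₗ-congʳ a₀≈0) (*ₗ-zeroˡ _))) (+ᴹ-identityˡ _))

  -- Gaussian elimination by induction on the length of `b`. A vector whose coefficient at the head
  -- of `b` is nonzero serves as pivot and clears this coefficient in the other vectors, which then
  -- lie in the span of `tail b`; a relation among the cleared vectors unfolds to one among the
  -- original vectors.
  dependent : ∀ {n} (b : Vector Carrierᴹ n) (x : Vector Carrierᴹ (suc n)) → (∀ i → x i ∈ ⟨ b ⟩) →
              ∃ λ a → lincomb a x ≈ᴹ 0ᴹ × ∃ λ i → ¬ (a i ≈ 0#)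
  -- The span of the empty family is zero, so `x zero` vanishes and the coefficient `1#` gives a
  -- nontrivial relation.
  dependent {zero} b x x∈ =
    (λ _ → 1#) , ≈ᴹ-trans (+ᴹ-identityʳ _) (≈ᴹ-trans (*ₗ-identityˡ _) (⟨_⟩.≈lincomb (x∈ zero))) ,
    zero , λ 1≈0 → 0≉1 (F.sym 1≈0)
  dependent {suc n} b x x∈ with Fin.any? (λ i → ¬? (⟨_⟩.coefficients (x∈ i) zero ≈? 0#))
  ... | no ¬pivot =
    let
      a , eq , i , aᵢ≉0 = dependent (tail b) (tail x) λ i → ∈⟨tail⟩ (x∈ (suc i))
        (decidable-stable (_ ≈? 0#) λ α≉0 → ¬pivot (suc i , α≉0))
    in
    -- Without a pivot all vectors lie in the span of `tail b`; there is one more of them than the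
    -- induction requires, and the first is left out.
    0# ∷ a , ≈ᴹ-trans (+ᴹ-cong (*ₗ-zeroˡ _) eq) (+ᴹ-identityˡ 0ᴹ) , suc i , aᵢ≉0
  ... | yes (p , αₚ≉0) =
    let a , eq , i , aᵢ≉0 = dependent (tail b) x′ (λ i → ∈⟨tail⟩ (x′∈ i) (x′-coefficient i))
    in
    insertAt a p (s a) , relation a eq , punchIn p i ,
    λ eq₀ → aᵢ≉0 (F.trans (F.reflexive (≡.sym (Vector.insertAt-punchIn a p (s a) i))) eq₀)
    where
    α : Vector Carrier (suc (suc n))
    α i = ⟨_⟩.coefficients (x∈ i) zero

    β : Carrier
    β = proj₁ (inverse (α p) αₚ≉0)

    γ : Vector Carrier (suc n)
    γ i = - (α (punchIn p i) *ᴿ β)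

    x′ : Vector Carrierᴹ (suc n)
    x′ i = x (punchIn p i) +ᴹ γ i *ₗ x p

    x′∈ : ∀ i → x′ i ∈ ⟨ b ⟩
    x′∈ i = IsSubspace.+-closed ⟨b⟩ (x∈ (punchIn p i)) (IsSubspace.*ₗ-closed ⟨b⟩ (γ i) (x∈ p))
      where ⟨b⟩ = ⟨⟩-isSubspace b

    -- The closure proofs of `⟨⟩-isSubspace` add and scale coefficients, so the left side is by
    -- computation the first coefficient of `x′∈ i`.
    x′-coefficient : ∀ i → α (punchIn p i) +ᴿ γ i *ᴿ α p ≈ 0#
    x′-coefficient i = F.trans (F.+-congˡ γα≈-α) (F.-‿inverseʳ _)
      where
      γα≈-α : γ i *ᴿ α p ≈ - α (punchIn p i)
      γα≈-α = F.trans (F.sym (RingProperties.-‿distribˡ-* ring _ _))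
        (F.-‿cong (F.trans (F.*-assoc _ β (α p)) (F.trans
          (F.*-congˡ (F.trans (F.*-comm β (α p)) (proj₂ (inverse (α p) αₚ≉0)))) (F.*-identityʳ _))))

    -- The total coefficient that the pivot `x p` receives when a combination of the `x′ i` is
    -- expanded.
    s : Vector Carrier (suc n) → Carrier
    s a = ΣR.sum λ i → a i *ᴿ γ i

    relation : ∀ a → lincomb a x′ ≈ᴹ 0ᴹ → lincomb (insertAt a p (s a)) x ≈ᴹ 0ᴹ
    relation a eq = begin
      lincomb (insertAt a p (s a)) x
        ≈⟨ lincomb-removeAt (insertAt a p (s a)) x p ⟩
      insertAt a p (s a) p *ₗ x p +ᴹ lincomb (removeAt (insertAt a p (s a)) p) (removeAt x p)
        ≈⟨ +ᴹ-cong (*ₗ-congʳ (F.reflexive (Vector.insertAt-lookup a p (s a))))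
                   (lincomb-congˡ (removeAt x p) λ i → F.reflexive (Vector.insertAt-punchIn a p (s a) i)) ⟩
      s a *ₗ x p +ᴹ lincomb a (removeAt x p)
        ≈⟨ +ᴹ-comm _ _ ⟩
      lincomb a (removeAt x p) +ᴹ s a *ₗ x p
        ≈⟨ +ᴹ-congˡ (lincomb-multiples a γ (x p)) ⟨
      lincomb a (removeAt x p) +ᴹ lincomb a (λ i → γ i *ₗ x p)
        ≈⟨ lincomb-+ʳ a (removeAt x p) (λ i → γ i *ₗ x p) ⟨
      lincomb a x′
        ≈⟨ eq ⟩
      0ᴹ ∎

  -- If `n < m`, the first `n + 1` vectors of `x` would satisfy a nontrivial relation by
  -- `dependent`.
  independent⇒≤ : ∀ {m n} {x : Vector Carrierᴹ m} {b : Vector Carrierᴹ n} →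
                  LinearlyIndependent x → (∀ i → x i ∈ ⟨ b ⟩) → m ≤ n
  independent⇒≤ {x = x} {b} indep x∈ = ℕ.≮⇒≥ λ n<m →
    let a , eq , i , aᵢ≉0 = dependent b (λ i → x (inject≤ i n<m)) (λ i → x∈ (inject≤ i n<m))
    in aᵢ≉0 (independent-inject≤ n<m indep a eq i)

  ∈⟨removeAt⟩ : ∀ {n} {a : Vector Carrier (suc n)} {x : Vector Carrierᴹ (suc n)} {p} →
                lincomb a x ≈ᴹ 0ᴹ → ¬ (a p ≈ 0#) → x p ∈ ⟨ removeAt x p ⟩
  ∈⟨removeAt⟩ {a = a} {x} {p} eq aₚ≉0 = IsSubspace.respects ⟨x⟩ β*≈ (IsSubspace.*ₗ-closed ⟨x⟩ β aₚxₚ∈)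
    where
    ⟨x⟩ = ⟨⟩-isSubspace (removeAt x p)
    β = proj₁ (inverse (a p) aₚ≉0)

    aₚxₚ∈ : (a p *ₗ x p) ∈ ⟨ removeAt x p ⟩
    aₚxₚ∈ = IsSubspace.respects ⟨x⟩
      (≈ᴹ-sym (inverseˡ-uniqueᴹ _ _ (≈ᴹ-trans (≈ᴹ-sym (lincomb-removeAt a x p)) eq)))
      (-‿closed ⟨x⟩ (removeAt a p , ≈ᴹ-refl))

    β*≈ : β *ₗ (a p *ₗ x p) ≈ᴹ x p
    β*≈ = ≈ᴹ-trans (≈ᴹ-sym (*ₗ-assoc β (a p) (x p))) (≈ᴹ-trans
      (*ₗ-congʳ (F.trans (F.*-comm β (a p)) (proj₂ (inverse (a p) aₚ≉0)))) (*ₗ-identityˡ _))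

  -- A nontrivial relation would express some `z p` through the others. Then `n - 1` vectors would
  -- span a space with `m ≥ n` independent vectors, against `independent⇒≤`.
  spanning⇒independent : ∀ {m n} {x : Vector Carrierᴹ m} {z : Vector Carrierᴹ n} → n ≤ m →
                         LinearlyIndependent x → (∀ i → x i ∈ ⟨ z ⟩) → LinearlyIndependent z
  spanning⇒independent {n = suc n} {x} {z} n≤m indep x∈ a eq p = decidable-stable (a p ≈? 0#) λ aₚ≉0 →
    ℕ.1+n≰n (ℕ.≤-trans n≤m (independent⇒≤ indep λ i → ⟨⟩-mono (z∈ aₚ≉0) (x∈ i)))
    where
    z∈ : ¬ (a p ≈ 0#) → ∀ j → z j ∈ ⟨ removeAt z p ⟩
    z∈ aₚ≉0 j with p Fin.≟ j
    ... | yes ≡.refl = ∈⟨removeAt⟩ {a = a} {z} eq aₚ≉0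
    ... | no p≢j = ≡.subst (λ k → z k ∈ ⟨ removeAt z p ⟩) (Fin.punchIn-punchOut p≢j)
                     (∈⟨⟩ (removeAt z p) (punchOut p≢j))

  independent-∷ : ∀ {n} {x : Vector Carrierᴹ n} {y} → LinearlyIndependent x → y ∉ ⟨ x ⟩ →
                  LinearlyIndependent (y ∷ x)
  independent-∷ {x = x} {y} indep y∉ a eq = λ { zero → a₀≈0 ; (suc i) → indep (tail a) eq′ i }
    where
    a₀≈0 : a zero ≈ 0#
    a₀≈0 = decidable-stable (a zero ≈? 0#) λ a₀≉0 → y∉ (∈⟨removeAt⟩ {a = a} {y ∷ x} {zero} eq a₀≉0)

    eq′ : lincomb (tail a) x ≈ᴹ 0ᴹ
    eq′ = ≈ᴹ-trans (≈ᴹ-sym (+ᴹ-identityˡ _)) (≈ᴹ-trans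
      (+ᴹ-congʳ (≈ᴹ-sym (≈ᴹ-trans (*ₗ-congʳ a₀≈0) (*ₗ-zeroˡ y)))) eq)

  -- Moves a newly adjoined vector behind `x`, so that an extension keeps `x` as its initial
  -- segment.
  independent-++∷ : ∀ {m n} {x : Vector Carrierᴹ m} {z : Vector Carrierᴹ n} {y} →
                    LinearlyIndependent (y ∷ (x ++ z)) → LinearlyIndependent (x ++ (y ∷ z))
  independent-++∷ {m} {n} {x} {z} {y} indep a eq i =
    F.trans (F.reflexive (≡.cong a (≡.sym (Fin.join-splitAt m (suc n) i)))) (a≈0 (splitAt m i))
    where
    aˡ = a ∘ (_↑ˡ suc n)
    aʳ = a ∘ (m ↑ʳ_)

    a′ : Vector Carrier (suc (m + n))
    a′ = head aʳ ∷ (aˡ ++ tail aʳ)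

    eq′ : lincomb a′ (y ∷ (x ++ z)) ≈ᴹ 0ᴹ
    eq′ = begin
      head aʳ *ₗ y +ᴹ lincomb (aˡ ++ tail aʳ) (x ++ z)
        ≈⟨ +ᴹ-congˡ (lincomb-++ (aˡ ++ tail aʳ) x z) ⟩
      head aʳ *ₗ y +ᴹ (lincomb ((aˡ ++ tail aʳ) ∘ (_↑ˡ n)) x +ᴹ lincomb ((aˡ ++ tail aʳ) ∘ (m ↑ʳ_)) z)
        ≈⟨ +ᴹ-congˡ (+ᴹ-cong (lincomb-congˡ x λ i → F.reflexive (Vector.lookup-++ˡ aˡ (tail aʳ) i))
                             (lincomb-congˡ z λ i → F.reflexive (Vector.lookup-++ʳ aˡ (tail aʳ) i))) ⟩
      head aʳ *ₗ y +ᴹ (lincomb aˡ x +ᴹ lincomb (tail aʳ) z)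
        ≈⟨ +ᴹ-assoc _ _ _ ⟨
      (head aʳ *ₗ y +ᴹ lincomb aˡ x) +ᴹ lincomb (tail aʳ) z
        ≈⟨ +ᴹ-congʳ (+ᴹ-comm _ _) ⟩
      (lincomb aˡ x +ᴹ head aʳ *ₗ y) +ᴹ lincomb (tail aʳ) z
        ≈⟨ +ᴹ-assoc _ _ _ ⟩
      lincomb aˡ x +ᴹ lincomb aʳ (y ∷ z)
        ≈⟨ lincomb-++ a x (y ∷ z) ⟨
      lincomb a (x ++ (y ∷ z))
        ≈⟨ eq ⟩
      0ᴹ ∎

    a≈0 : ∀ j → a (join m (suc n) j) ≈ 0#
    a≈0 (inj₁ j)       = F.trans (F.reflexive (≡.sym (Vector.lookup-++ˡ aˡ (tail aʳ) j)))
                               (indep a′ eq′ (suc (j ↑ˡ n)))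
    a≈0 (inj₂ zero)    = indep a′ eq′ zero
    a≈0 (inj₂ (suc j)) = F.trans (F.reflexive (≡.sym (Vector.lookup-++ʳ aˡ (tail aʳ) j)))
                               (indep a′ eq′ (suc (m ↑ʳ j)))

  module Decidability (_≈ᴹ?_ : Decidable₂ _≈ᴹ_) where

    _∈⟨_⟩? : ∀ {n} y (x : Vector Carrierᴹ n) → Dec (y ∈ ⟨ x ⟩)
    y ∈⟨ x ⟩? = map′ (λ (a , y≈) → a , y≈) (λ (a , y≈) → a , y≈)
      (search (λ a≈b y≈ → ≈ᴹ-trans y≈ (lincomb-congˡ x a≈b)) (λ a → y ≈ᴹ? lincomb a x))

    -- Greedy extension: the vectors of `y` are tried from the last to the first, and one is
    -- adjoined when it is not yet in the span. The hypothesis is phrased for `x ++ []` because this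
    -- is the answer for empty `y`.
    extend-independent : ∀ {m p} {x : Vector Carrierᴹ m} → LinearlyIndependent (x ++ []) →
      (y : Vector Carrierᴹ p) → ∃ λ e → ∃ λ (z : Vector Carrierᴹ e) →
      LinearlyIndependent (x ++ z) × (∀ i → y i ∈ ⟨ x ++ z ⟩)
    extend-independent {p = zero} indep y = 0 , [] , indep , λ ()
    extend-independent {m} {suc p} {x} indep y with extend-independent indep (tail y)
    ... | e , z , indep′ , y∈ with head y ∈⟨ x ++ z ⟩?
    ...   | yes y₀∈ = e , z , indep′ , λ { zero → y₀∈ ; (suc i) → y∈ i }
    ...   | no  y₀∉ = suc e , y₀z , independent-++∷ {x = x} {z} (independent-∷ indep′ y₀∉) , λ
      { zero    → ʳ∈ zero
      ; (suc i) → ⟨⟩-mono (++-∈ {P = ⟨ x ++ y₀z ⟩} {x} {z} ˡ∈ (ʳ∈ ∘ suc)) (y∈ i)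
      }
      where
      y₀z : Vector Carrierᴹ (suc e)
      y₀z = head y ∷ z

      ˡ∈ : ∀ i → x i ∈ ⟨ x ++ y₀z ⟩
      ˡ∈ i = ≡.subst (_∈ ⟨ x ++ y₀z ⟩) (Vector.lookup-++ˡ x y₀z i) (∈⟨⟩ (x ++ y₀z) (i ↑ˡ suc e))

      ʳ∈ : ∀ i → y₀z i ∈ ⟨ x ++ y₀z ⟩
      ʳ∈ i = ≡.subst (_∈ ⟨ x ++ y₀z ⟩) (Vector.lookup-++ʳ x y₀z i) (∈⟨⟩ (x ++ y₀z) (m ↑ʳ i))

    -- The members of `b` are offered to `extend-independent`. The old and the new basis are both
    -- independent and spanning, so two uses of `independent⇒≤` give the equality of lengths.
    completeToBasis : ∀ {n m} {x : Vector Carrierᴹ n} {b : Vector Carrierᴹ m} →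
      LinearlyIndependent x → LinearlyIndependent b → (∀ y → y ∈ ⟨ b ⟩) →
      ∃ λ e → ∃ λ (z : Vector Carrierᴹ e) →
      n + e ≡ m × LinearlyIndependent (x ++ z) × (∀ y → y ∈ ⟨ x ++ z ⟩)
    completeToBasis {n} {m} {x} {b} x-indep b-indep b-spans =
      let e , z , indep , b∈ = extend-independent x++[]-indep b in
      e , z , ℕ.≤-antisym (independent⇒≤ indep λ i → b-spans ((x ++ z) i)) (independent⇒≤ b-indep b∈) ,
      indep , λ y → ⟨⟩-mono b∈ (b-spans y)
      where
      x++[]-indep : LinearlyIndependent (x ++ [])
      x++[]-indep a eq i =
          F.trans (F.reflexive (≡.cong a (≡.sym (Fin.join-splitAt n 0 i)))) (a≈0 (splitAt n i))
        where
        a≈0 : ∀ j → a (join n 0 j) ≈ 0#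
        a≈0 (inj₁ j) = x-indep (a ∘ (_↑ˡ 0))
          (≈ᴹ-trans (≈ᴹ-sym (≈ᴹ-trans (lincomb-++ a x []) (+ᴹ-identityʳ _))) eq) j

  -- Coordinates and change of basis.

  module Basis {m} {b : Vector Carrierᴹ m} (b-indep : LinearlyIndependent b) (b-spans : ∀ y → y ∈ ⟨ b ⟩) where

    coordinates : Carrierᴹ → Vector Carrier m
    coordinates y = ⟨_⟩.coefficients (b-spans y)

    coordinates-unique : ∀ {y a} → y ≈ᴹ lincomb a b → ∀ i → coordinates y i ≈ a i
    coordinates-unique {y} y≈ =
      independent-injective b-indep (≈ᴹ-trans (≈ᴹ-sym (⟨_⟩.≈lincomb (b-spans y))) y≈)

    -- A basis reduces equality of vectors to finitely many equalities in the field; this supplies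
    -- the parameter of `Decidability`.
    _≈ᴹ?_ : Decidable₂ _≈ᴹ_
    x ≈ᴹ? y = map′
      (λ eq → ≈ᴹ-trans (⟨_⟩.≈lincomb (b-spans x))
        (≈ᴹ-trans (lincomb-congˡ b eq) (≈ᴹ-sym (⟨_⟩.≈lincomb (b-spans y)))))
      (λ x≈y → coordinates-unique (≈ᴹ-trans x≈y (⟨_⟩.≈lincomb (b-spans y))))
      (Fin.all? λ i → coordinates x i ≈? coordinates y i)

  module BasisChange {m} {b b′ : Vector Carrierᴹ m}
    (b-indep : LinearlyIndependent b) (b-spans : ∀ y → y ∈ ⟨ b ⟩)
    (b′-indep : LinearlyIndependent b′) (b′-spans : ∀ y → y ∈ ⟨ b′ ⟩) where

    open Basis b-indep b-spans using (coordinates; coordinates-unique)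
    open Basis b′-indep b′-spans using () renaming (coordinates to coordinates′)

    changeBasis : Carrierᴹ → Carrierᴹ
    changeBasis y = lincomb (coordinates y) b′

    -- Any expression of `y` through `b`, not just the chosen coordinates, may be used to evaluate
    -- the map. Congruence and linearity then reduce to the rules for `lincomb`.
    changeBasis-lincomb : ∀ {y} a → y ≈ᴹ lincomb a b → changeBasis y ≈ᴹ lincomb a b′
    changeBasis-lincomb a y≈ = lincomb-congˡ b′ (coordinates-unique y≈)

    changeBasis-basis : ∀ i → changeBasis (b i) ≈ᴹ b′ i
    changeBasis-basis i = ≈ᴹ-trans (changeBasis-lincomb (δ i) (≈ᴹ-sym (lincomb-δ i b))) (lincomb-δ i b′)

    private
      expand : ∀ y → y ≈ᴹ lincomb (coordinates y) b
      expand y = ⟨_⟩.≈lincomb (b-spans y)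

      changeBasis-*ₗ : ∀ r y → changeBasis (r *ₗ y) ≈ᴹ r *ₗ changeBasis y
      changeBasis-*ₗ r y = ≈ᴹ-trans
        (changeBasis-lincomb _ (≈ᴹ-trans (*ₗ-congˡ (expand y)) (≈ᴹ-sym (lincomb-*ˡ r _ b))))
        (lincomb-*ˡ r _ b′)

      changeBasis-cong : ∀ {x y} → x ≈ᴹ y → changeBasis x ≈ᴹ changeBasis y
      changeBasis-cong {y = y} x≈y = changeBasis-lincomb _ (≈ᴹ-trans x≈y (expand y))

    changeBasis-isIsomorphism : IsLeftModuleIsomorphism rawLeftModule rawLeftModule changeBasis
    changeBasis-isIsomorphism = record
      { isLeftModuleMonomorphism = record
        { isLeftModuleHomomorphism = record
          { +ᴹ-isGroupHomomorphism = record
            { isMonoidHomomorphism = record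
              { isMagmaHomomorphism = record
                { isRelHomomorphism = record { cong = changeBasis-cong }
                ; homo = λ x y → ≈ᴹ-trans
                    (changeBasis-lincomb _ (≈ᴹ-trans (+ᴹ-cong (expand x) (expand y))
                      (≈ᴹ-sym (lincomb-+ˡ _ _ b))))
                    (lincomb-+ˡ _ _ b′)
                }
              ; ε-homo = ≈ᴹ-trans (changeBasis-lincomb _ (≈ᴹ-sym (lincomb-zeroˡ b))) (lincomb-zeroˡ b′)
              }
            ; ⁻¹-homo = λ x → ≈ᴹ-trans (changeBasis-cong (≈ᴹ-sym (-1*ₗ x)))
                (≈ᴹ-trans (changeBasis-*ₗ (- 1#) x) (-1*ₗ _))
            }
          ; *ₗ-homo = changeBasis-*ₗ
          }
        ; injective = λ {x} {y} eq → ≈ᴹ-trans (expand x)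
            (≈ᴹ-trans (lincomb-congˡ b (independent-injective b′-indep eq)) (≈ᴹ-sym (expand y)))
        }
      ; surjective = λ y → lincomb (coordinates′ y) b , λ z≈ →
          ≈ᴹ-trans (changeBasis-lincomb _ z≈) (≈ᴹ-sym (⟨_⟩.≈lincomb (b′-spans y)))
      }

-- The action of GL(m, K) on subsets of V.

module Orbits {c ℓ c′ ℓ′ v ℓv} {q Q m : ℕ}
  (F : GF c ℓ q) (K : GF c′ ℓ′ Q) (ι : FieldEmbedding F K)
  (V : LeftModule (GF.ring K) v ℓv) (Y : Vector (LeftModule.Carrierᴹ V) m) where

  open Setting F K ι V Y
  open LeftModule V
  private
    module K = GF K
    module F = GF F
    module ι = RingHomomorphism ι
    module PF = LincombProperties V/F
    module PK = LincombProperties V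
    module K/F = LinearAlgebra K/F
    module PKF = LincombProperties K/F
    module DF = Dimension F V/F
    module DK = Dimension K V
    module DKF = Dimension F K/F
  open PF using () renaming (⟨_⟩ to ⟨_⟩ᶠ)
  open PK using () renaming (⟨_⟩ to ⟨_⟩ᴷ)
  open PKF using () renaming (⟨_⟩ to ⟨_⟩ᴷᶠ)

  -- Surjectivity provides `h`; each law for `h` is checked after applying `g` and pulled back by
  -- injectivity.
  IsGL-inverse : ∀ {g} → IsGL g → ∃ λ h → IsGL h × (∀ x → g (h x) ≈ᴹ x)
  IsGL-inverse {g} isGL = h , isGL⁻¹ , gh
    where
    open IsLeftModuleIsomorphism isGL
    h : Carrierᴹ → Carrierᴹ
    h y = proj₁ (surjective y)

    gh : ∀ y → g (h y) ≈ᴹ y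
    gh y = proj₂ (surjective y) ≈ᴹ-refl

    isGL⁻¹ : IsGL h
    isGL⁻¹ = record
      { isLeftModuleMonomorphism = record
        { isLeftModuleHomomorphism = record
          { +ᴹ-isGroupHomomorphism = record
            { isMonoidHomomorphism = record
              { isMagmaHomomorphism = record
                { isRelHomomorphism = record
                  { cong = λ {x} {y} x≈y → injective (≈ᴹ-trans (gh x) (≈ᴹ-trans x≈y (≈ᴹ-sym (gh y)))) }
                ; homo = λ x y → injective (≈ᴹ-trans (gh (x +ᴹ y)) (≈ᴹ-sym
                    (≈ᴹ-trans (+ᴹ-homo (h x) (h y)) (+ᴹ-cong (gh x) (gh y)))))
                }
              ; ε-homo = injective (≈ᴹ-trans (gh 0ᴹ) (≈ᴹ-sym 0ᴹ-homo))
              }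
            ; ⁻¹-homo = λ x → injective (≈ᴹ-trans (gh (-ᴹ x)) (≈ᴹ-sym
                (≈ᴹ-trans (-ᴹ-homo (h x)) (-ᴹ‿cong (gh x)))))
            }
          ; *ₗ-homo = λ a x → injective (≈ᴹ-trans (gh (a *ₗ x)) (≈ᴹ-sym
              (≈ᴹ-trans (*ₗ-homo a (h x)) (*ₗ-congˡ (gh x)))))
          }
        ; injective = λ {x} {y} hx≈hy → ≈ᴹ-trans (≈ᴹ-sym (gh x)) (≈ᴹ-trans (⟦⟧-cong hx≈hy) (gh y))
        }
      ; surjective = λ y → g y , λ {z} z≈gy → injective (≈ᴹ-trans (gh z) z≈gy)
      }

  -- The set `image h W` is closed under `≈ᴹ`, so for `T` to coincide with it `T` has to be closed
  -- as well.
  Orbit-sym : ∀ {s t} {T : Pred Carrierᴹ t} {W : Pred Carrierᴹ s} →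
              (∀ {x y} → x ≈ᴹ y → x ∈ T → y ∈ T) → W ∈ Orbit T → T ∈ Orbit W
  Orbit-sym {T = T} {W} T-resp (g , isGL , W⊆ , ⊆W) = h , proj₁ (proj₂ inv) , T⊆ , ⊆T
    where
    inv = IsGL-inverse isGL
    h = proj₁ inv
    gh = proj₂ (proj₂ inv)
    open IsLeftModuleIsomorphism isGL

    T⊆ : T ⊆ image h W
    T⊆ {t} t∈T = g t , ⊆W (t , t∈T , ≈ᴹ-refl) , injective (≈ᴹ-sym (gh (g t)))

    ⊆T : image h W ⊆ T
    ⊆T {y} (w , w∈W , y≈hw) =
      let t , t∈T , w≈gt = W⊆ w∈W
      in T-resp (injective (≈ᴹ-sym (≈ᴹ-trans (⟦⟧-cong y≈hw) (≈ᴹ-trans (gh w) w≈gt)))) t∈T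

  Orbit-trans : ∀ {s t r} {T : Pred Carrierᴹ t} {W : Pred Carrierᴹ s} {X : Pred Carrierᴹ r} →
                W ∈ Orbit T → X ∈ Orbit W → X ∈ Orbit T
  Orbit-trans {T = T} {W} {X} (g , g-isGL , W⊆ , ⊆W) (h , h-isGL , X⊆ , ⊆X) =
    h ∘ g , isLeftModuleIsomorphism ≈ᴹ-trans g-isGL h-isGL , X⊆′ , ⊆X′
    where
    open IsLeftModuleIsomorphism h-isGL using (⟦⟧-cong)

    X⊆′ : X ⊆ image (h ∘ g) T
    X⊆′ x∈X =
      let w , w∈W , x≈hw = X⊆ x∈X
          t , t∈T , w≈gt = W⊆ w∈W
      in t , t∈T , ≈ᴹ-trans x≈hw (⟦⟧-cong w≈gt)

    ⊆X′ : image (h ∘ g) T ⊆ X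
    ⊆X′ (t , t∈T , x≈) = ⊆X (g t , ⊆W (t , t∈T , ≈ᴹ-refl) , x≈)

  module _ {g} (isGL : IsGL g) where

    open IsLeftModuleIsomorphism isGL

    lincomb-homo : ∀ {n} (a : Vector K.Carrier n) x → g (OverK.lincomb a x) ≈ᴹ OverK.lincomb a (g ∘ x)
    lincomb-homo {zero}  a x = 0ᴹ-homo
    lincomb-homo {suc n} a x = ≈ᴹ-trans (+ᴹ-homo _ _) (+ᴹ-cong (*ₗ-homo _ _) (lincomb-homo (tail a) (tail x)))

    image-independent : ∀ {n} {x : Vector Carrierᴹ n} →
                        OverK.LinearlyIndependent x → OverK.LinearlyIndependent (g ∘ x)
    image-independent {x = x} indep a eq =
      indep a (injective (≈ᴹ-trans (lincomb-homo a x) (≈ᴹ-trans eq (≈ᴹ-sym 0ᴹ-homo))))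

    -- A K-linear map is F-linear through `ι`, so it carries F-generators to F-generators with the
    -- same coefficients.
    image-Span : ∀ {n} {x y : Vector Carrierᴹ n} → (∀ i → g (x i) ≈ᴹ y i) →
                 image g (OverF.Span (OverF.Range x)) ≐ ⟨ y ⟩ᶠ
    image-Span {x = x} {y} gx≈y = image⊆ , ⊆image
      where
      g-lincomb : ∀ a → g (OverF.lincomb a x) ≈ᴹ OverF.lincomb a y
      g-lincomb a = ≈ᴹ-trans (lincomb-homo (ι.⟦_⟧ ∘ a) x) (PF.lincomb-congʳ a gx≈y)

      image⊆ : image g (OverF.Span (OverF.Range x)) ⊆ ⟨ y ⟩ᶠ
      image⊆ (t , t∈ , z≈gt) =
        let a PF., t≈ = proj₁ (PF.SpanRange≐⟨⟩ x) t∈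
        in a PF., ≈ᴹ-trans z≈gt (≈ᴹ-trans (⟦⟧-cong t≈) (g-lincomb a))

      ⊆image : ⟨ y ⟩ᶠ ⊆ image g (OverF.Span (OverF.Range x))
      ⊆image (a PF., z≈) =
        OverF.lincomb a x , proj₂ (PF.SpanRange≐⟨⟩ x) (a PF., ≈ᴹ-refl) , ≈ᴹ-trans z≈ (≈ᴹ-sym (g-lincomb a))

  IsSubspaceᴷ⇒ᶠ : ∀ {p} {P : Pred Carrierᴹ p} → OverK.IsSubspace P → OverF.IsSubspace P
  IsSubspaceᴷ⇒ᶠ P = record
    { respects  = OverK.IsSubspace.respects P
    ; 0-closed  = OverK.IsSubspace.0-closed P
    ; +-closed  = OverK.IsSubspace.+-closed P
    ; *ₗ-closed = λ a → OverK.IsSubspace.*ₗ-closed P ι.⟦ a ⟧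
    }

  -- A nonzero `a` has an inverse, whose image would turn `ι a = 0` into `1 = 0` in K.
  ι-injective : ∀ {a} → ι.⟦ a ⟧ K.≈ K.0# → a F.≈ F.0#
  ι-injective {a} ιa≈0 = decidable-stable (a ≈? F.0#) λ a≉0 →
    let b , ab≈1 = F.inverse a a≉0 in
    K.0≉1 (K.trans (K.sym (K.zeroˡ ι.⟦ b ⟧)) (K.trans (K.*-congʳ (K.sym ιa≈0))
      (K.trans (K.sym (ι.*-homo a b)) (K.trans (ι.⟦⟧-cong ab≈1) ι.1#-homo))))
    where open FiniteField F

  -- Normal forms of subspaces.

  -- Up to g ∈ G, the family z is the family Y₁,…,Y_n.
  record NormalForm {n s} (r : ℕ) (r≤n : r ≤ n) (W : Pred Carrierᴹ s)
                    : Set (c ⊔ ℓ ⊔ c′ ⊔ ℓ′ ⊔ v ⊔ ℓv ⊔ s) where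
    field
      z             : Vector Carrierᴹ n
      u             : Vector K.Carrier r
      z-independent : OverK.LinearlyIndependent z
      u-independent : K/F.LinearlyIndependent (K.1# ∷ u)

    w : Carrierᴹ
    w = OverK.lincomb u λ i → z (inject≤ i r≤n)

    field
      W≐ : W ≐ ⟨ w ∷ z ⟩ᶠ

    w≈ : w ≈ᴹ OverK.lincomb (PK.pad r≤n u) z
    w≈ = ≈ᴹ-sym (PK.lincomb-pad r≤n u z)

    -- Compares coefficients at the K-independent `z i`. Thus every K-relation of `w ∷ z` is a
    -- multiple of (-1, u₁, ..., u_r, 0, ..., 0).
    relation : ∀ e → OverK.lincomb e (w ∷ z) ≈ᴹ 0ᴹ → ∀ i → e zero K.* PK.pad r≤n u i K.+ e (suc i) K.≈ K.0#
    relation e eq = z-independent _ (≈ᴹ-trans (PK.lincomb-+ˡ _ (tail e) z) (≈ᴹ-trans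
      (+ᴹ-congʳ (≈ᴹ-trans (PK.lincomb-*ˡ (e zero) _ z) (*ₗ-congˡ (≈ᴹ-sym w≈)))) eq))

    -- As `1 ≤ r`, the coefficient at the first `z` gives `a₀ u₁ + a₁ = 0` with `a₀`, `a₁` in F, and
    -- independence of 1 and u₁ forces `a₀ = 0`. The remaining coefficients then vanish by
    -- `relation`.
    independent : 1 ≤ r → OverF.LinearlyIndependent (w ∷ z)
    independent 1≤r a eq = λ { zero → a₀≈0 1≤r r≤n u u-independent rel ; (suc i) → ι-injective (ιa≈0 i) }
      where
      rel : ∀ i → ι.⟦ a zero ⟧ K.* PK.pad r≤n u i K.+ ι.⟦ a (suc i) ⟧ K.≈ K.0#
      rel = relation (ι.⟦_⟧ ∘ a) eq

      a₀≈0 : ∀ {r} → 1 ≤ r → (r≤n : r ≤ n) (u : Vector K.Carrier r) → K/F.LinearlyIndependent (K.1# ∷ u) →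
             (∀ i → ι.⟦ a zero ⟧ K.* PK.pad r≤n u i K.+ ι.⟦ a (suc i) ⟧ K.≈ K.0#) → a zero F.≈ F.0#
      -- The F-relation put in is `a₁ · 1 + a₀ · u₁ + 0 · u₂ + ⋯`, and its coefficient at u₁ is read
      -- off.
      a₀≈0 (s≤s _) (s≤s r≤n) u indep rel = indep (a (suc zero) ∷ (a zero ∷ λ _ → F.0#)) (K.trans
        (K.+-cong (K.*-identityʳ _) (K.trans (K.+-congˡ (PKF.lincomb-zeroˡ (tail u))) (K.+-identityʳ _)))
        (K.trans (K.+-comm _ _) (rel zero))) (suc zero)

      ιa≈0 : ∀ i → ι.⟦ a (suc i) ⟧ K.≈ K.0#
      ιa≈0 i = K.trans (K.sym (K.+-identityˡ _)) (K.trans (K.+-congʳ (K.sym (K.trans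
        (K.*-congʳ (K.trans (ι.⟦⟧-cong (a₀≈0 1≤r r≤n u u-independent rel)) ι.0#-homo)) (K.zeroˡ _)))) (rel i))

  Ωᵣ⇒NormalForm : OverK.LinearlyIndependent Y → ∀ {n s} (n≤m : n ≤ m) {r 1≤r r≤n} {W : Pred Carrierᴹ s} →
                  W ∈ Ωᵣ n≤m (r , 1≤r , r≤n) → NormalForm r r≤n W
  Ωᵣ⇒NormalForm Y-indep n≤m {r} {r≤n = r≤n} (u , u-indep , g , isGL , W⊆ , ⊆W) = record
    { z             = λ i → g (Y (inject≤ i n≤m))
    ; u             = u
    ; z-independent = image-independent isGL (PK.independent-inject≤ n≤m Y-indep)
    ; u-independent = u-indep
    ; W≐            = (λ x∈ → proj₁ image≐ (W⊆ x∈)) , λ x∈ → ⊆W (proj₂ image≐ x∈)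
    }
    where
    image≐ = image-Span isGL λ
      { zero    → lincomb-homo isGL u (λ i → Y (inject≤ (inject≤ i r≤n) n≤m))
      ; (suc i) → ≈ᴹ-refl
      }

  -- G is transitive on K-independent families of length `n`: `z` is completed to a basis of V, and
  -- `Y` is mapped to this basis.
  NormalForm⇒Ωᵣ : OverK.LinearlyIndependent Y → (∀ y → y ∈ ⟨ Y ⟩ᴷ) →
                  ∀ {n s} (n≤m : n ≤ m) {r 1≤r r≤n} {W : Pred Carrierᴹ s} →
                  NormalForm r r≤n W → W ∈ Ωᵣ n≤m (r , 1≤r , r≤n)
  NormalForm⇒Ωᵣ Y-indep Y-spans {n} n≤m {r} {r≤n = r≤n} {W} nf = u , u-independent , g , isGL ,
    (λ x∈ → proj₂ image≐ (proj₁ W≐ x∈)) , λ x∈ → proj₂ W≐ (proj₁ image≐ x∈)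
    where
    open NormalForm nf

    -- With the equation of lengths as an argument, matching on it identifies `m` with `n + e` and
    -- makes `Y` and `z ++ z′` families of the same length.
    automorphism : ∀ {e} {z′ : Vector Carrierᴹ e} → n + e ≡ m →
      OverK.LinearlyIndependent (z ++ z′) → (∀ y → y ∈ ⟨ z ++ z′ ⟩ᴷ) →
      ∃ λ g → IsGL g × (∀ i → g (Y (inject≤ i n≤m)) ≈ᴹ z i)
    automorphism {e} {z′} ≡.refl indep spans =
      changeBasis , changeBasis-isIsomorphism , λ i → ≈ᴹ-trans (changeBasis-basis (inject≤ i n≤m))
        (≈ᴹ-reflexive (≡.trans (≡.cong (z ++ z′) (inject≤≡↑ˡ i)) (Vector.lookup-++ˡ z z′ i)))
      where
      open DK.BasisChange Y-indep Y-spans indep spans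
      inject≤≡↑ˡ : ∀ i → inject≤ i n≤m ≡ i ↑ˡ e
      inject≤≡↑ˡ i = Fin.toℕ-injective (≡.trans (Fin.toℕ-inject≤ i n≤m) (≡.sym (Fin.toℕ-↑ˡ i e)))

    exists : ∃ λ g → IsGL g × (∀ i → g (Y (inject≤ i n≤m)) ≈ᴹ z i)
    exists =
      let e , z′ , n+e≡m , indep , spans = completeToBasis z-independent Y-indep Y-spans
      in automorphism n+e≡m indep spans
      where open DK.Decidability (DK.Basis._≈ᴹ?_ Y-indep Y-spans)

    g = proj₁ exists
    isGL = proj₁ (proj₂ exists)
    gY≈z = proj₂ (proj₂ exists)

    image≐ = image-Span isGL {y = w ∷ z} λ
      { zero    → ≈ᴹ-trans (lincomb-homo isGL u (λ i → Y (inject≤ (inject≤ i r≤n) n≤m)))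
                           (PK.lincomb-congʳ u λ i → gY≈z (inject≤ i r≤n))
      ; (suc i) → gY≈z i
      }

  -- The generators `w ∷ z` form an F-basis of `W`; over K the vector `w` is redundant, which leaves
  -- `z` as a basis of the K-span.
  NormalForm⇒Ω : ∀ {n s r r≤n} {W : Pred Carrierᴹ s} → 1 ≤ r → NormalForm {n} r r≤n W → Ω (suc n) n W
  NormalForm⇒Ω {n} {r≤n = r≤n} {W} 1≤r nf = record
    { isSubspace = PF.isSubspace-≐ W≐ (PF.⟨⟩-isSubspace (w ∷ z))
    ; dimOverF   = w ∷ z , record
      { independent = independent 1≤r
      ; spans       = (λ x∈ → proj₂ (PF.SpanRange≐⟨⟩ (w ∷ z)) (proj₁ W≐ x∈)) ,
                      λ x∈ → proj₂ W≐ (proj₁ (PF.SpanRange≐⟨⟩ (w ∷ z)) x∈)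
      }
    ; dimOverK   = z , record
      { independent = z-independent
      ; spans       = (λ x∈ → proj₂ (PK.SpanRange≐⟨⟩ z) (PK.Span-least ⟨z⟩ W⊆⟨z⟩ x∈)) ,
                      λ x∈ → PK.⟨⟩⊆Span {S = W} (λ i → proj₂ W≐ (PF.∈⟨⟩ (w ∷ z) (suc i)))
                        (proj₁ (PK.SpanRange≐⟨⟩ z) x∈)
      }
    }
    where
    open NormalForm nf
    ⟨z⟩ = PK.⟨⟩-isSubspace z

    W⊆⟨z⟩ : W ⊆ ⟨ z ⟩ᴷ
    W⊆⟨z⟩ x∈ = PF.⟨⟩-least (IsSubspaceᴷ⇒ᶠ ⟨z⟩)
      (λ { zero → PK.pad r≤n u PK., w≈ ; (suc i) → PK.∈⟨⟩ z i }) (proj₁ W≐ x∈)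

  -- Invariance of the rank r.

  -- With b′ = A b and b = B b′, a relation η of b′ becomes the relation d = Aᵀ η of b,
  -- a multiple of (−1, u₁, …, u_r, 0, …, 0), and η = Bᵀ d has its entries in the F-span of d.
  NormalForm-rank≤ : ∀ {n s r r′ r≤n r′≤n} {W : Pred Carrierᴹ s} → 1 ≤ r′ →
                     NormalForm {n} r r≤n W → NormalForm {n} r′ r′≤n W → r′ ≤ r
  NormalForm-rank≤ {n} {r = r} {r′} {r≤n} {r′≤n} 1≤r′ nf nf′ =
    -- The `r′ + 1` independent elements 1, u′₁, ..., u′_r′ lie in the F-span of the `r + 1` entries
    -- of `scaled`.
    s≤s⁻¹ (DKF.independent⇒≤ {x = K.1# ∷ N′.u} N′.u-independent λ { zero → 1∈S ; (suc i) → u′∈S i })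
    where
    module N = NormalForm nf
    module N′ = NormalForm nf′

    b b′ : Vector Carrierᴹ (suc n)
    b  = N.w ∷ N.z
    b′ = N′.w ∷ N′.z

    b′∈⟨b⟩ : ∀ j → b′ j ∈ ⟨ b ⟩ᶠ
    b′∈⟨b⟩ j = proj₁ N.W≐ (proj₂ N′.W≐ (PF.∈⟨⟩ b′ j))

    b∈⟨b′⟩ : ∀ i → b i ∈ ⟨ b′ ⟩ᶠ
    b∈⟨b′⟩ i = proj₁ N′.W≐ (proj₂ N.W≐ (PF.∈⟨⟩ b i))

    A B : Fin (suc n) → Vector F.Carrier (suc n)
    A j = PF.⟨_⟩.coefficients (b′∈⟨b⟩ j)
    B i = PF.⟨_⟩.coefficients (b∈⟨b′⟩ i)

    -- Expanding `b′` through `b` and back gives coefficients that are unique because `b′` is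
    -- F-independent.
    AB≈δ : ∀ j k → PF.ΣR.sum (λ i → A j i F.* B i k) F.≈ PF.δ j k
    AB≈δ j = PF.independent-injective {x = b′} (N′.independent 1≤r′) (begin
      OverF.lincomb (λ k → PF.ΣR.sum λ i → A j i F.* B i k) b′
        ≈⟨ PF.lincomb-lincomb (A j) B b′ ⟨
      OverF.lincomb (A j) (λ i → OverF.lincomb (B i) b′)
        ≈⟨ PF.lincomb-congʳ (A j) (λ i → PF.⟨_⟩.≈lincomb (b∈⟨b′⟩ i)) ⟨
      OverF.lincomb (A j) b
        ≈⟨ PF.⟨_⟩.≈lincomb (b′∈⟨b⟩ j) ⟨
      b′ j
        ≈⟨ PF.lincomb-δ j b′ ⟨
      OverF.lincomb (PF.δ j) b′ ∎)
      where open SetoidReasoning ≈ᴹ-setoid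

    η d : Vector K.Carrier (suc n)
    η = (K.- K.1#) ∷ PK.pad r′≤n N′.u
    d i = K/F.lincomb (λ j → A j i) η

    η-relation : OverK.lincomb η b′ ≈ᴹ 0ᴹ
    η-relation = ≈ᴹ-trans (+ᴹ-cong (PK.-1*ₗ N′.w) (≈ᴹ-sym N′.w≈)) (-ᴹ‿inverseˡ N′.w)

    d-relation : OverK.lincomb d b ≈ᴹ 0ᴹ
    d-relation = begin
      OverK.lincomb d b
        ≈⟨ PK.lincomb-congˡ b (λ i → PK.ΣR.sum-cong-≋ λ j → K.*-comm ι.⟦ A j i ⟧ (η j)) ⟩
      OverK.lincomb (λ i → PK.ΣR.sum λ j → η j K.* ι.⟦ A j i ⟧) b
        ≈⟨ PK.lincomb-lincomb η (λ j → ι.⟦_⟧ ∘ A j) b ⟨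
      OverK.lincomb η (λ j → OverF.lincomb (A j) b)
        ≈⟨ PK.lincomb-congʳ η (λ j → PF.⟨_⟩.≈lincomb (b′∈⟨b⟩ j)) ⟨
      OverK.lincomb η b′
        ≈⟨ η-relation ⟩
      0ᴹ ∎
      where open SetoidReasoning ≈ᴹ-setoid

    η≈Bᵀd : ∀ k → η k K.≈ K/F.lincomb (λ i → B i k) d
    η≈Bᵀd k = begin
      η k
        ≈⟨ PKF.lincomb-δ k η ⟨
      K/F.lincomb (PKF.δ k) η
        ≈⟨ PKF.lincomb-congˡ η δ≈BA ⟩
      K/F.lincomb (λ j → PF.ΣR.sum λ i → B i k F.* A j i) η
        ≈⟨ PKF.lincomb-lincomb (λ i → B i k) (λ i j → A j i) η ⟨
      K/F.lincomb (λ i → B i k) d ∎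
      where
      open SetoidReasoning K.≈-setoid
      δ≈BA : ∀ j → PKF.δ k j F.≈ PF.ΣR.sum λ i → B i k F.* A j i
      δ≈BA j = F.trans (F.reflexive (PKF.δ-sym k j)) (F.trans (F.sym (AB≈δ j k))
        (PF.ΣR.sum-cong-≋ λ i → F.*-comm (A j i) (B i k)))

    -- By `N.relation` each entry of `d` is zero or, up to sign, an entry of this vector.
    scaled : Vector K.Carrier (suc r)
    scaled i = d zero K.* (K.1# ∷ N.u) i

    S = PKF.⟨⟩-isSubspace scaled
    module S = K/F.IsSubspace S

    d∈S : ∀ i → d i ∈ ⟨ scaled ⟩ᴷᶠ
    d∈S zero    = S.respects (K.*-identityʳ (d zero)) (PKF.∈⟨⟩ scaled zero)
    d∈S (suc i) = S.respects
      (K.sym (+-inverseʳ-unique _ _ (N.relation d d-relation i)))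
      (PKF.-‿closed S (PK.pad-∈ {P = λ y → (d zero K.* y) ∈ ⟨ scaled ⟩ᴷᶠ} r≤n
        (S.respects (K.sym (K.zeroʳ (d zero))) S.0-closed) (λ j → PKF.∈⟨⟩ scaled (suc j)) i))
      where open RingProperties K.ring using (+-inverseʳ-unique)

    η∈S : ∀ k → η k ∈ ⟨ scaled ⟩ᴷᶠ
    η∈S k = S.respects (K.sym (η≈Bᵀd k)) (PKF.lincomb∈ S (λ i → B i k) d∈S)

    1∈S : K.1# ∈ ⟨ scaled ⟩ᴷᶠ
    1∈S = S.respects (RingProperties.-‿involutive K.ring K.1#) (PKF.-‿closed S (η∈S zero))

    u′∈S : ∀ i → N′.u i ∈ ⟨ scaled ⟩ᴷᶠ
    u′∈S i = ≡.subst (_∈ ⟨ scaled ⟩ᴷᶠ) (PK.pad-inject≤ r′≤n N′.u i) (η∈S (suc (inject≤ i r′≤n)))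

  -- Reduction of a K-relation to F-independent coefficients.

  -- The last three fields say that x and y together have the same F-span as w.
  record ReducedRelation {N} (α : Vector K.Carrier N) (w : Vector Carrierᴹ N)
                         : Set (lsuc (c ⊔ ℓv) ⊔ ℓ ⊔ c′ ⊔ ℓ′ ⊔ v) where
    field
      {r s}         : ℕ
      size          : r + s ≡ N
      u             : Vector K.Carrier r
      x             : Vector Carrierᴹ r
      y             : Vector Carrierᴹ s
      u-independent : K/F.LinearlyIndependent u
      α∈            : ∀ i → α i ∈ ⟨ u ⟩ᴷᶠ
      lincomb≈      : OverK.lincomb α w ≈ᴹ OverK.lincomb u x
      x∈            : ∀ i → x i ∈ ⟨ w ⟩ᶠ
      y∈            : ∀ i → y i ∈ ⟨ w ⟩ᶠ
      w∈            : ∀ {P : Pred Carrierᴹ (c ⊔ ℓv)} → OverF.IsSubspace P →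
                      (∀ i → x i ∈ P) → (∀ i → y i ∈ P) → ∀ i → w i ∈ P

  -- Induction on the relation. If `α zero` is not in the F-span of the coefficients kept so far, it
  -- is kept together with `w zero`. Otherwise `α₀ = Σ aᵢ uᵢ`, the term `α₀ w₀` is absorbed by
  -- replacing each `xᵢ` with `xᵢ + aᵢ w₀`, and `w₀` joins `y`, whose members do not occur in the
  -- reduced relation.
  reduceRelation : ∀ {N} (α : Vector K.Carrier N) (w : Vector Carrierᴹ N) → ReducedRelation α w
  reduceRelation {zero} α w = record
    { r = 0 ; s = 0 ; size = ≡.refl ; u = [] ; x = [] ; y = []
    ; u-independent = λ _ _ () ; α∈ = λ () ; lincomb≈ = ≈ᴹ-refl ; x∈ = λ () ; y∈ = λ () ; w∈ = λ _ _ _ ()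
    }
  reduceRelation {suc N} α w with reduceRelation (tail α) (tail w)
  ... | ρ with α zero ∈⟨ ReducedRelation.u ρ ⟩?
    where open DKF.Decidability (FiniteField._≈?_ K)
  ...   | no α₀∉ = record
    { size          = ≡.cong suc size
    ; u             = α zero ∷ u
    ; x             = w zero ∷ x
    ; y             = y
    ; u-independent = DKF.independent-∷ u-independent α₀∉
    ; α∈            = λ { zero → PKF.∈⟨⟩ (α zero ∷ u) zero
                        ; (suc i) → PKF.⟨⟩-mono (λ j → PKF.∈⟨⟩ (α zero ∷ u) (suc j)) (α∈ i) }
    ; lincomb≈      = +ᴹ-congˡ lincomb≈
    ; x∈            = λ { zero → PF.∈⟨⟩ w zero ; (suc i) → tail⊆ (x∈ i) }
    ; y∈            = λ i → tail⊆ (y∈ i)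
    ; w∈            = λ { P x∈P y∈P zero → x∈P zero ; P x∈P y∈P (suc i) → w∈ P (x∈P ∘ suc) y∈P i }
    }
    where
    open ReducedRelation ρ
    tail⊆ : ⟨ tail w ⟩ᶠ ⊆ ⟨ w ⟩ᶠ
    tail⊆ = PF.⟨⟩-mono λ i → PF.∈⟨⟩ w (suc i)
  ...   | yes (a PKF., α₀≈) = record
    { size          = ≡.trans (ℕ.+-suc r s) (≡.cong suc size)
    ; u             = u
    ; x             = x′
    ; y             = w zero ∷ y
    ; u-independent = u-independent
    ; α∈            = λ { zero → a PKF., α₀≈ ; (suc i) → α∈ i }
    ; lincomb≈      = lincomb≈′
    ; x∈            = λ i → ⟨w⟩.+-closed (tail⊆ (x∈ i)) (⟨w⟩.*ₗ-closed (a i) (PF.∈⟨⟩ w zero))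
    ; y∈            = λ { zero → PF.∈⟨⟩ w zero ; (suc i) → tail⊆ (y∈ i) }
    ; w∈            = λ { P x′∈P y∈P zero → y∈P zero
                        ; P x′∈P y∈P (suc i) → w∈ P (x∈P P x′∈P (y∈P zero)) (y∈P ∘ suc) i }
    }
    where
    open ReducedRelation ρ
    module ⟨w⟩ = OverF.IsSubspace (PF.⟨⟩-isSubspace w)

    x′ : Vector Carrierᴹ r
    x′ i = x i +ᴹ ι.⟦ a i ⟧ *ₗ w zero

    tail⊆ : ⟨ tail w ⟩ᶠ ⊆ ⟨ w ⟩ᶠ
    tail⊆ = PF.⟨⟩-mono λ i → PF.∈⟨⟩ w (suc i)

    -- The absorption is undone by `xᵢ = x′ᵢ − aᵢ w₀`, so no part of the F-span is lost.
    x∈P : ∀ {P : Pred Carrierᴹ (c ⊔ ℓv)} → OverF.IsSubspace P →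
          (∀ i → x′ i ∈ P) → w zero ∈ P → ∀ i → x i ∈ P
    x∈P P x′∈P w₀∈P i = P.respects
      (≈ᴹ-trans (+ᴹ-assoc _ _ _) (≈ᴹ-trans (+ᴹ-congˡ (-ᴹ‿inverseʳ _)) (+ᴹ-identityʳ _)))
      (P.+-closed (x′∈P i) (PF.-‿closed P (P.*ₗ-closed (a i) w₀∈P)))
      where module P = OverF.IsSubspace P

    lincomb≈′ : OverK.lincomb α w ≈ᴹ OverK.lincomb u x′
    lincomb≈′ = begin
      α zero *ₗ w zero +ᴹ OverK.lincomb (tail α) (tail w)
        ≈⟨ +ᴹ-comm _ _ ⟩
      OverK.lincomb (tail α) (tail w) +ᴹ α zero *ₗ w zero
        ≈⟨ +ᴹ-cong lincomb≈ (*ₗ-congʳ (K.trans α₀≈ (PK.ΣR.sum-cong-≋ λ i → K.*-comm ι.⟦ a i ⟧ (u i)))) ⟩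
      OverK.lincomb u x +ᴹ (PK.ΣR.sum λ i → u i K.* ι.⟦ a i ⟧) *ₗ w zero
        ≈⟨ +ᴹ-congˡ (PK.lincomb-multiples u (ι.⟦_⟧ ∘ a) (w zero)) ⟨
      OverK.lincomb u x +ᴹ OverK.lincomb u (λ i → ι.⟦ a i ⟧ *ₗ w zero)
        ≈⟨ PK.lincomb-+ʳ u x (λ i → ι.⟦ a i ⟧ *ₗ w zero) ⟨
      OverK.lincomb u x′ ∎
      where open SetoidReasoning ≈ᴹ-setoid

  -- Existence of normal forms.

  -- Multiplication by `t` is F-linear on K by commutativity.
  lincomb-scale : ∀ {n} (a : Vector F.Carrier n) t (x : Vector K.Carrier n) →
                  K/F.lincomb a (λ i → t K.* x i) K.≈ t K.* K/F.lincomb a x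
  lincomb-scale a t x = K.sym (K.trans (SemiringSum.*-distribˡ-sum K.semiring t λ i → ι.⟦ a i ⟧ K.* x i)
    (PK.ΣR.sum-cong-≋ λ i → x∙yz≈y∙xz t ι.⟦ a i ⟧ (x i)))
    where open CommutativeSemigroupProperties K.*-commutativeSemigroup using (x∙yz≈y∙xz)

  nonempty : ∀ {n} (a : Vector K.Carrier n) (x : Vector Carrierᴹ n) → ¬ (OverK.lincomb a x ≈ᴹ 0ᴹ) → 1 ≤ n
  nonempty {zero}  a x ≉0 = contradiction ≈ᴹ-refl ≉0
  nonempty {suc n} a x ≉0 = s≤s z≤n

  -- Reindexing: under `r + s ≡ n` the first `r` members of `x ++ y`, reached by `inject≤` in
  -- `NormalForm`, are those of `x`.
  normalForm : ∀ {n r s t} {W : Pred Carrierᴹ t} {u : Vector K.Carrier r}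
               {x : Vector Carrierᴹ r} {y : Vector Carrierᴹ s} → r + s ≡ n →
               OverK.LinearlyIndependent (x ++ y) → K/F.LinearlyIndependent (K.1# ∷ u) →
               W ≐ ⟨ OverK.lincomb u x ∷ (x ++ y) ⟩ᶠ → ∃ λ (r≤n : r ≤ n) → NormalForm r r≤n W
  normalForm {r = r} {s} {u = u} {x} {y} ≡.refl z-indep u-indep (W⊆ , ⊆W) = ℕ.m≤m+n r s , record
    { z             = x ++ y
    ; u             = u
    ; z-independent = z-indep
    ; u-independent = u-indep
    ; W≐            = (λ v∈ → PF.⟨⟩-cong (≈ᴹ-sym ∘ w≈) (W⊆ v∈)) , λ v∈ → ⊆W (PF.⟨⟩-cong w≈ v∈)
    }
    where
    z∘inject≤ : ∀ i → (x ++ y) (inject≤ i (ℕ.m≤m+n r s)) ≡ x i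
    z∘inject≤ i = ≡.trans
      (≡.cong (x ++ y) (Fin.toℕ-injective (≡.trans (Fin.toℕ-inject≤ i _) (≡.sym (Fin.toℕ-↑ˡ i s)))))
      (Vector.lookup-++ˡ x y i)

    w≈ : ∀ i → (OverK.lincomb u (λ j → (x ++ y) (inject≤ j (ℕ.m≤m+n r s))) ∷ (x ++ y)) i ≈ᴹ
               (OverK.lincomb u x ∷ (x ++ y)) i
    w≈ zero    = PK.lincomb-congʳ u λ j → ≈ᴹ-reflexive (z∘inject≤ j)
    w≈ (suc i) = ≈ᴹ-refl

  Ω⇒NormalForm : ∀ {n s} {W : Pred Carrierᴹ s} → Ω (suc n) n W →
                 ∃ λ r → 1 ≤ r × ∃ λ (r≤n : r ≤ n) → NormalForm r r≤n W
  Ω⇒NormalForm {n} {W = W} W∈Ω = fromReduced (reduceRelation α ω)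
    where
    open Ω W∈Ω
    ω = proj₁ dimOverF
    module ω = OverF.IsBasis (proj₂ dimOverF)
    β = proj₁ dimOverK
    module β = OverK.IsBasis (proj₂ dimOverK)

    ω∈W : ∀ i → ω i ∈ W
    ω∈W i = proj₂ ω.spans (proj₂ (PF.SpanRange≐⟨⟩ ω) (PF.∈⟨⟩ ω i))

    W⊆⟨ω⟩ : W ⊆ ⟨ ω ⟩ᶠ
    W⊆⟨ω⟩ x∈W = proj₁ (PF.SpanRange≐⟨⟩ ω) (proj₁ ω.spans x∈W)

    -- The `n + 1` members of the F-basis `ω` lie in the K-span of `W`, which has the K-basis `β` of
    -- length `n`.
    dependence = DK.dependent β ω λ i →
      proj₁ (PK.SpanRange≐⟨⟩ β) (proj₁ β.spans (PK.⊆Span {S = W} (ω∈W i)))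
    α = proj₁ dependence

    fromReduced : ReducedRelation α ω → ∃ λ r → 1 ≤ r × ∃ λ (r≤n : r ≤ n) → NormalForm r r≤n W
    -- With no coefficient kept, every `α i` would lie in the span of the empty family and vanish.
    fromReduced record { r = zero ; α∈ = α∈ } =
      let _ , _ , p , αₚ≉0 = dependence in contradiction (PKF.⟨_⟩.≈lincomb (α∈ p)) αₚ≉0
    -- One of the `r + 1` terms is solved for, which leaves rank `r`. If `r` were 0, then `x zero`
    -- would be an empty sum, against `x₀≉0`.
    fromReduced ρ@record { r = suc r } = r , nonempty u′ x₋ (λ eq → x₀≉0 (≈ᴹ-trans x₀≈ eq)) ,
      normalForm size′ z-indep u′-indep W≐
      where
      open ReducedRelation ρ hiding (r)

      u₀≉0 : ¬ (u zero K.≈ K.0#)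
      u₀≉0 u₀≈0 = F.0≉1 (F.sym (u-independent (PF.δ zero) (K.trans (PKF.lincomb-δ zero u) u₀≈0) zero))

      μ : K.Carrier
      μ = proj₁ (K.inverse (u zero) u₀≉0)

      μu₀≈1 : μ K.* u zero K.≈ K.1#
      μu₀≈1 = K.trans (K.*-comm _ _) (proj₂ (K.inverse (u zero) u₀≉0))

      u′ : Vector K.Carrier r
      u′ i = μ K.* u (suc i)

      -- Solving for `x zero` changes signs; they are put on the vectors, so that `1, u′` is a plain
      -- multiple of `u` and inherits its independence.
      x₋ : Vector Carrierᴹ r
      x₋ i = -ᴹ x (suc i)

      z : Vector Carrierᴹ (r + s)
      z = x₋ ++ y

      size′ : r + s ≡ n
      size′ = ℕ.suc-injective size

      u′-indep : K/F.LinearlyIndependent (K.1# ∷ u′)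
      u′-indep a eq = u-independent a (begin
        K/F.lincomb a u                                       ≈⟨ PKF.lincomb-congʳ a u≈ ⟩
        K/F.lincomb a (λ i → u zero K.* (K.1# ∷ u′) i)         ≈⟨ lincomb-scale a (u zero) (K.1# ∷ u′) ⟩
        u zero K.* K/F.lincomb a (K.1# ∷ u′)                   ≈⟨ K.*-congˡ eq ⟩
        u zero K.* K.0#                                       ≈⟨ K.zeroʳ _ ⟩
        K.0#                                                  ∎)
        where
        open SetoidReasoning K.≈-setoid
        u≈ : ∀ i → u i K.≈ u zero K.* (K.1# ∷ u′) i
        u≈ zero    = K.sym (K.*-identityʳ (u zero))
        u≈ (suc i) = K.sym (K.trans (K.sym (K.*-assoc _ _ _))
          (K.trans (K.*-congʳ (proj₂ (K.inverse (u zero) u₀≉0))) (K.*-identityˡ _)))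

      x₀≈ : x zero ≈ᴹ OverK.lincomb u′ x₋
      x₀≈ = begin
        x zero
          ≈⟨ *ₗ-identityˡ (x zero) ⟨
        K.1# *ₗ x zero
          ≈⟨ *ₗ-congʳ μu₀≈1 ⟨
        (μ K.* u zero) *ₗ x zero
          ≈⟨ *ₗ-assoc μ (u zero) (x zero) ⟩
        μ *ₗ (u zero *ₗ x zero)
          ≈⟨ *ₗ-congˡ (inverseˡ-uniqueᴹ _ _ (≈ᴹ-trans (≈ᴹ-sym lincomb≈) α-relation)) ⟩
        μ *ₗ (-ᴹ OverK.lincomb (tail u) (tail x))
          ≈⟨ *ₗ-congˡ (PK.lincomb--ʳ (tail u) (tail x)) ⟨
        μ *ₗ OverK.lincomb (tail u) x₋
          ≈⟨ PK.lincomb-*ˡ μ (tail u) x₋ ⟨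
        OverK.lincomb u′ x₋ ∎
        where
        open SetoidReasoning ≈ᴹ-setoid
        open LeftModuleProperties V using (inverseˡ-uniqueᴹ)
        α-relation : OverK.lincomb α ω ≈ᴹ 0ᴹ
        α-relation = proj₁ (proj₂ dependence)

      y∈P : ∀ {p} {P : Pred Carrierᴹ p} → (∀ i → z i ∈ P) → ∀ i → y i ∈ P
      y∈P {P = P} z∈P i = ≡.subst P (Vector.lookup-++ʳ x₋ y i) (z∈P (r ↑ʳ i))

      x₋∈ : ∀ {p} {P : Pred Carrierᴹ p} → (∀ i → z i ∈ P) → ∀ i → x₋ i ∈ P
      x₋∈ {P = P} z∈P i = ≡.subst P (Vector.lookup-++ˡ x₋ y i) (z∈P (i ↑ˡ s))

      -- A subspace contains `x (suc i)` along with its negative, so `x zero` and `z` generate all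
      -- of `x` and `y`, hence `ω`. The level of `P` is that of the spans `⟨_⟩` it is applied to.
      ω∈P : ∀ {P : Pred Carrierᴹ (c ⊔ ℓv)} → OverF.IsSubspace P → x zero ∈ P → (∀ i → z i ∈ P) → ∀ i → ω i ∈ P
      ω∈P {P} P-sub x₀∈P z∈P = w∈ P-sub
        (λ { zero    → x₀∈P
           ; (suc i) → OverF.IsSubspace.respects P-sub (-ᴹ-involutive (x (suc i)))
                         (PF.-‿closed P-sub (x₋∈ {P = P} z∈P i)) })
        (y∈P {P = P} z∈P)
        where open LeftModuleProperties V using (-ᴹ-involutive)

      -- Otherwise the `n` vectors of `z` alone would F-span the `n + 1` independent members of `ω`.
      x₀≉0 : ¬ (x zero ≈ᴹ 0ᴹ)
      x₀≉0 x₀≈0 = ℕ.1+n≰n (ℕ.≤-trans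
        (DF.independent⇒≤ ω.independent (ω∈P ⟨z⟩ (OverF.IsSubspace.respects ⟨z⟩ (≈ᴹ-sym x₀≈0)
          (OverF.IsSubspace.0-closed ⟨z⟩)) (PF.∈⟨⟩ z)))
        (ℕ.≤-reflexive size′))
        where ⟨z⟩ = PF.⟨⟩-isSubspace z

      b : Vector Carrierᴹ (suc (r + s))
      b = OverK.lincomb u′ x₋ ∷ z

      W≐ : W ≐ ⟨ b ⟩ᶠ
      W≐ = (λ x∈W → PF.⟨⟩-mono ω∈⟨b⟩ (W⊆⟨ω⟩ x∈W)) , PF.⟨⟩-least isSubspace b∈W
        where
        ω∈⟨b⟩ : ∀ i → ω i ∈ ⟨ b ⟩ᶠ
        ω∈⟨b⟩ = ω∈P (PF.⟨⟩-isSubspace b)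
          (OverF.IsSubspace.respects (PF.⟨⟩-isSubspace b) (≈ᴹ-sym x₀≈) (PF.∈⟨⟩ b zero)) (PF.∈⟨⟩ b ∘ suc)

        ⟨ω⟩⊆W : ⟨ ω ⟩ᶠ ⊆ W
        ⟨ω⟩⊆W = PF.⟨⟩-least isSubspace ω∈W

        b∈W : ∀ i → b i ∈ W
        b∈W zero    = OverF.IsSubspace.respects isSubspace x₀≈ (⟨ω⟩⊆W (x∈ zero))
        b∈W (suc i) = PF.++-∈ {P = W} {x₋} {y} (λ j → PF.-‿closed isSubspace (⟨ω⟩⊆W (x∈ (suc j))))
          (⟨ω⟩⊆W ∘ y∈) i

      -- Since `x zero` is a K-combination of `x₋`, the `n` vectors of `z` span over K a space
      -- containing the `n` independent members of `β`.
      z-indep : OverK.LinearlyIndependent z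
      z-indep = DK.spanning⇒independent (ℕ.≤-reflexive size′) β.independent λ i →
        PK.Span-least ⟨z⟩ W⊆⟨z⟩ (proj₂ β.spans (proj₂ (PK.SpanRange≐⟨⟩ β) (PK.∈⟨⟩ β i)))
        where
        ⟨z⟩ = PK.⟨⟩-isSubspace z

        W⊆⟨z⟩ : W ⊆ ⟨ z ⟩ᴷ
        W⊆⟨z⟩ x∈W = PF.⟨⟩-least (IsSubspaceᴷ⇒ᶠ ⟨z⟩)
          (λ { zero → PK.lincomb∈ ⟨z⟩ u′ (x₋∈ {P = ⟨ z ⟩ᴷ} (PK.∈⟨⟩ z)) ; (suc i) → PK.∈⟨⟩ z i })
          (proj₁ W≐ x∈W)

  -- The disjoint decompositions into rank classes and orbits.

  Ωᵣ-Orbit : ∀ {n s t} (n≤m : n ≤ m) {r : [1⋯ n ]} {T : Pred Carrierᴹ t} {W : Pred Carrierᴹ s} →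
             T ∈ Ωᵣ n≤m r → W ∈ Orbit T → W ∈ Ωᵣ n≤m r
  Ωᵣ-Orbit n≤m {r} (u , u-indep , T∈) W∈ = u , u-indep , Orbit-trans T∈ W∈

  module Decomposition {n} (n≤m : n ≤ m) (Y-basis : OverK.IsBasis Y U) where

    Y-indep : OverK.LinearlyIndependent Y
    Y-indep = OverK.IsBasis.independent Y-basis

    Y-spans : ∀ y → y ∈ ⟨ Y ⟩ᴷ
    Y-spans y = proj₁ (PK.SpanRange≐⟨⟩ Y) (proj₁ (OverK.IsBasis.spans Y-basis) tt)

    Ωᵣ⇒Ω : ∀ {s r} {W : Pred Carrierᴹ s} → W ∈ Ωᵣ n≤m r → Ω (suc n) n W
    Ωᵣ⇒Ω {r = _ , 1≤r , r≤n} W∈ = NormalForm⇒Ω 1≤r (Ωᵣ⇒NormalForm Y-indep n≤m {1≤r = 1≤r} {r≤n} W∈)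

    -- Both inclusions pass through normal forms. Two normal forms of one `W` have equal rank by
    -- comparing them in both directions.
    Ωᵣ-decomposition : ∀ {s} → IsDisjointUnion SameValue (Ω {s} (suc n) n) (Ωᵣ n≤m)
    Ωᵣ-decomposition = record
      { union    =
          (λ W∈Ω → let r , 1≤r , r≤n , nf = Ω⇒NormalForm W∈Ω in
            (r , 1≤r , r≤n) , NormalForm⇒Ωᵣ Y-indep Y-spans n≤m {1≤r = 1≤r} nf) ,
          λ (r , W∈) → Ωᵣ⇒Ω {r = r} W∈
      ; disjoint = λ { {_ , 1≤r , r≤n} {_ , 1≤r′ , r′≤n} W∈ W∈′ →
          let nf  = Ωᵣ⇒NormalForm Y-indep n≤m {1≤r = 1≤r} {r≤n} W∈
              nf′ = Ωᵣ⇒NormalForm Y-indep n≤m {1≤r = 1≤r′} {r′≤n} W∈′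
          in ℕ.≤-antisym (NormalForm-rank≤ 1≤r nf′ nf) (NormalForm-rank≤ 1≤r′ nf nf′) }
      }

    module _ {s f} {𝓕 : [1⋯ n ] → Pred (Pred Carrierᴹ s) f}
             (reps : ∀ r → IsRepresentatives (Ωᵣ n≤m r) (𝓕 r)) where

      open module Reps r = IsRepresentatives (reps r)

      Ωᵣ-Orbit-sym : ∀ {r} {T W : Pred Carrierᴹ s} → T ∈ Ωᵣ n≤m r → W ∈ Orbit T → T ∈ Orbit W
      Ωᵣ-Orbit-sym {r} T∈ = Orbit-sym (OverF.IsSubspace.respects (Ω.isSubspace (Ωᵣ⇒Ω {r = r} T∈)))

      -- `SameValue` identifies only the numbers; irrelevance of `≤` identifies the bounds too, so
      -- that both representatives lie in the same `𝓕 i`. By symmetry both lie in the orbit of `W`,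
      -- and `unique` applies.
      same-representative : ∀ {r r′} {T′ T″ W : Pred Carrierᴹ s} → SameValue r r′ →
                            T′ ∈ 𝓕 r → T″ ∈ 𝓕 r′ → W ∈ Orbit T′ → W ∈ Orbit T″ → T′ ≐ T″
      same-representative {r , 1≤r , r≤n} {.r , 1≤r′ , r≤n′} ≡.refl T′∈ T″∈ W∈ W∈′
        with ≡.refl ← ℕ.≤-irrelevant 1≤r 1≤r′ | ≡.refl ← ℕ.≤-irrelevant r≤n r≤n′ =
        unique i (Ωᵣ-Orbit n≤m {i} (contained i T′∈) W∈) T′∈ T″∈
          (Ωᵣ-Orbit-sym {i} (contained i T′∈) W∈) (Ωᵣ-Orbit-sym {i} (contained i T″∈) W∈′)
        where
        i : [1⋯ n ]
        i = r , 1≤r , r≤n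

      orbit-decomposition : IsDisjointUnion (SameRep SameValue 𝓕) (Ω {s} (suc n) n) (OrbitAt 𝓕)
      orbit-decomposition = record
        { union    =
            (λ W∈Ω → let r , W∈ = proj₁ (IsDisjointUnion.union Ωᵣ-decomposition) W∈Ω
                         T′ , T′∈𝓕 , T′∈ = exists r W∈
                     in (r , T′ , T′∈𝓕) , Orbit-sym (OverF.IsSubspace.respects (Ω.isSubspace W∈Ω)) T′∈) ,
            λ ((r , _ , T′∈𝓕) , W∈) → Ωᵣ⇒Ω {r = r} (Ωᵣ-Orbit n≤m {r} (contained r T′∈𝓕) W∈)
        ; disjoint = λ { {r , _ , T′∈𝓕} {r′ , _ , T″∈𝓕} W∈ W∈′ →
            let r≡r′ = IsDisjointUnion.disjoint Ωᵣ-decomposition {r} {r′}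
                  (Ωᵣ-Orbit n≤m {r} (contained r T′∈𝓕) W∈) (Ωᵣ-Orbit n≤m {r′} (contained r′ T″∈𝓕) W∈′)
            in r≡r′ , same-representative {r} {r′} r≡r′ T′∈𝓕 T″∈𝓕 W∈ W∈′ }
        }

lemma3p1 : ∀ {c ℓ c′ ℓ′ v ℓv s f} (q m l k : ℕ) → IsPrimePower q →
    3 ≤ k → (k≤ : k ≤ (m + 1) ⊓ l) →
    (F : GF c ℓ q) (K : GF c′ ℓ′ (q ^ l)) (ι : FieldEmbedding F K)
    (V : LeftModule (GF.ring K) v ℓv) (Y : Vector (LeftModule.Carrierᴹ V) m) →
    LinearAlgebra.IsBasis V Y U →
    let
      open Setting F K ι V Y
      Subset = Pred (LeftModule.Carrierᴹ V) s
    in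
    IsDisjointUnion SameValue (Ω {s} k (k ∸ 1)) (Ωᵣ (k∸1≤m k≤))
    × ((𝓕 : [1⋯ k ∸ 1 ] → Pred Subset f) →
       (∀ r → IsRepresentatives (Ωᵣ (k∸1≤m k≤) r) (𝓕 r)) →
       IsDisjointUnion (SameRep SameValue 𝓕) (Ω {s} k (k ∸ 1)) (OrbitAt 𝓕))
-- Since `3 ≤ k`, the number `k` is a successor, and `k ∸ 1` computes to `n`.
lemma3p1 q m l (suc n) _ (s≤s _) k≤ F K ι V Y Y-basis = Ωᵣ-decomposition , λ _ → orbit-decomposition
  where
  open Orbits F K ι V Y
  open Decomposition (k∸1≤m k≤) Y-basis
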